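{- For each fixed $\alpha$ with $0<\alpha\le 1$, there is a polynomial-time approximation scheme for $\alpha$-MaxCover: for every fixed $\beta\in(0,1)$ there is a polynomial-time algorithm that, given an instance of $\alpha$-MaxCover, returns at most $K$ sets covering at least $\beta\cdot\mathrm{OPT}$ elements.
   Context: A MaxCover instance $(N,{\mathcal{S}},K)$: a set $N$ of $n$ elements, a family ${\mathcal{S}}$ of $m$ subsets of $N$, an integer $K$; goal: at most $K$ sets maximizing the number of covered elements; $\mathrm{OPT}$ is the optimum value. $\alpha$-MaxCover is MaxCover restricted to instances for which there is an integer $p$ such that every element belongs to at least $p$ sets of ${\mathcal{S}}$ and $p/m\ge\alpha$. -}

module Defs where

open import Data.Bool.Base using (Bool; true; false)
open import Data.Empty using (⊥)
open import Data.Fin.Base using (Fin; zero; suc)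
open import Data.Fin.Subset as Subset using (Subset; inside; outside; _∪_; ∣_∣)
open import Data.Fin.Subset.Properties using (_∈?_; ∣⊥∣≡0)
open import Data.Integer.Base using (+_)
open import Data.List.Base as List using (List; []; _∷_; _++_; filter)
open import Data.List.Extrema.Nat using (max; v≤max⁺; argmax-sel)
open import Data.List.Membership.Propositional using () renaming (_∈_ to _∈ₗ_)
open import Data.List.Membership.Propositional.Properties
  using (∈-map⁺; ∈-map⁻; ∈-++⁺ˡ; ∈-++⁺ʳ; ∈-filter⁺; ∈-filter⁻)
open import Data.List.Relation.Unary.Any as Any using (here)
open import Data.Nat.Base as ℕ using (ℕ; zero; suc; _+_; _*_; _^_; _≤_; z≤n)
import Data.Nat.Properties as ℕ
open import Data.Nat.Binary.Base using (ℕᵇ; 2[1+_]; 1+[2_]; fromℕ)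
open import Data.Product.Base using (Σ; ∃; ∃-syntax; _×_; _,_; proj₁; proj₂)
open import Data.Rational.Base as ℚ using (ℚ; 0ℚ; 1ℚ)
import Data.Rational.Properties as ℚ
open import Data.Sum.Base using (_⊎_; inj₁; inj₂)
open import Data.Vec.Base as Vec using (Vec; []; _∷_; lookup; count; _[_]≔_)
open import Relation.Binary.PropositionalEquality
  using (_≡_; refl; sym; trans; cong; subst)
open import Relation.Binary.Definitions using (tri<; tri≈; tri>)
open import Relation.Nullary using (¬_; yes; no)
open import Relation.Nullary.Negation using (contradiction)

-- Real numbers as two-sided (located) Dedekind cuts of ℚ:
-- L q means q < x, and U q means x < q.
record ℝ : Set₁ where
  field
    L U         : ℚ → Set
    L-inhabited : ∃ L
    U-inhabited : ∃ U
    L-down      : ∀ {q r} → q ℚ.< r → L r → L q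
    L-open      : ∀ {q} → L q → ∃[ r ] q ℚ.< r × L r
    U-up        : ∀ {q r} → q ℚ.< r → U q → U r
    U-open      : ∀ {r} → U r → ∃[ q ] q ℚ.< r × U q
    disjoint    : ∀ {q} → L q → U q → ⊥
    located     : ∀ {q r} → q ℚ.< r → L q ⊎ U r

  L<U : ∀ {q r} → L q → U r → q ℚ.< r
  L<U {q} {r} l u with ℚ.<-cmp q r
  ... | tri< q<r _ _ = q<r
  ... | tri≈ _ refl _ = contradiction u (disjoint l)
  ... | tri> _ _ r<q = contradiction u (disjoint (L-down r<q l))

open ℝ public using (L; U)

infix 4 _<ᴿ_ _≤ᴿ_

_<ᴿ_ : ℝ → ℝ → Set
x <ᴿ y = ∃[ q ] U x q × L y q

_≤ᴿ_ : ℝ → ℝ → Set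
x ≤ᴿ y = ∀ q → L x q → L y q

private
  q<q+1 : ∀ q → q ℚ.< q ℚ.+ 1ℚ
  q<q+1 q = subst (ℚ._< q ℚ.+ 1ℚ) (ℚ.+-identityʳ q)
                  (ℚ.+-monoʳ-< q (ℚ.positive⁻¹ 1ℚ))

  q-1<q : ∀ q → q ℚ.+ (ℚ.- 1ℚ) ℚ.< q
  q-1<q q = subst (q ℚ.+ (ℚ.- 1ℚ) ℚ.<_) (ℚ.+-identityʳ q)
                  (ℚ.+-monoʳ-< q (ℚ.negative⁻¹ (ℚ.- 1ℚ)))

fromℚ : ℚ → ℝ
fromℚ x = record
  { L           = ℚ._< x
  ; U           = x ℚ.<_
  ; L-inhabited = _ , q-1<q x
  ; U-inhabited = _ , q<q+1 x
  ; L-down      = ℚ.<-trans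
  ; L-open      = λ q<x → let r , q<r , r<x = ℚ.<-dense q<x in r , q<r , r<x
  ; U-up        = λ q<r x<q → ℚ.<-trans x<q q<r
  ; U-open      = λ x<r → let q , x<q , q<r = ℚ.<-dense x<r in q , q<r , x<q
  ; disjoint    = λ q<x x<q → ℚ.<-asym q<x x<q
  ; located     = loc
  }
  where
  loc : ∀ {q r} → q ℚ.< r → (q ℚ.< x) ⊎ (x ℚ.< r)
  loc {q} q<r with q ℚ.<? x
  ... | yes q<x = inj₁ q<x
  ... | no  q≮x = inj₂ (ℚ.≤-<-trans (ℚ.≮⇒≥ q≮x) q<r)

ℕ→ℚ : ℕ → ℚ
ℕ→ℚ n = + n ℚ./ 1

fromℕᴿ : ℕ → ℝ
fromℕᴿ n = fromℚ (ℕ→ℚ n)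

0ᴿ 1ᴿ : ℝ
0ᴿ = fromℚ 0ℚ
1ᴿ = fromℚ 1ℚ

private
  instance
    ℕ→ℚ-nonNeg : ∀ {n} → ℚ.NonNegative (ℕ→ℚ n)
    ℕ→ℚ-nonNeg {n} = ℚ.normalize-nonNeg n 1

  -- For v > 0, apply locatedness of x to q/v < s/v.
  scale-located : ∀ (x : ℝ) v {q s} → q ℚ.< s →
    (∃[ r ] L x r × q ℚ.< r ℚ.* ℕ→ℚ v) ⊎ (∃[ r ] U x r × r ℚ.* ℕ→ℚ v ℚ.< s)
  scale-located x zero {q} {s} q<s with q ℚ.<? 0ℚ
  ... | yes q<0 = let r , l = ℝ.L-inhabited x in
                  inj₁ (r , l , subst (q ℚ.<_) (sym (ℚ.*-zeroʳ r)) q<0)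
  ... | no  q≮0 = let r , u = ℝ.U-inhabited x in
                  inj₂ (r , u , subst (ℚ._< s) (sym (ℚ.*-zeroʳ r))
                                      (ℚ.≤-<-trans (ℚ.≮⇒≥ q≮0) q<s))
  scale-located x v@(suc _) {q} {s} q<s = go (ℝ.located x (ℚ.*-monoˡ-<-pos w⁻¹ q<s))
    where
    w : ℚ
    w = ℕ→ℚ v
    instance
      w-pos : ℚ.Positive w
      w-pos = ℚ.normalize-pos v 1
      w-nz : ℚ.NonZero w
      w-nz = ℚ.pos⇒nonZero w
    w⁻¹ : ℚ
    w⁻¹ = ℚ.1/ w
    instance
      w⁻¹-pos : ℚ.Positive w⁻¹
      w⁻¹-pos = ℚ.1/pos⇒pos w
    cancel : ∀ p → p ℚ.* w⁻¹ ℚ.* w ≡ p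
    cancel p = trans (ℚ.*-assoc p w⁻¹ w)
      (trans (cong (p ℚ.*_) (ℚ.*-inverseˡ w)) (ℚ.*-identityʳ p))
    go : L x (q ℚ.* w⁻¹) ⊎ U x (s ℚ.* w⁻¹) →
      (∃[ r ] L x r × q ℚ.< r ℚ.* w) ⊎ (∃[ r ] U x r × r ℚ.* w ℚ.< s)
    go (inj₁ l) = let r , q′<r , l′ = ℝ.L-open x l in
      inj₁ (r , l′ , subst (ℚ._< r ℚ.* w) (cancel q) (ℚ.*-monoˡ-<-pos w q′<r))
    go (inj₂ u) = let r , r<s′ , u′ = ℝ.U-open x u in
      inj₂ (r , u′ , subst (r ℚ.* w ℚ.<_) (cancel s) (ℚ.*-monoˡ-<-pos w r<s′))

infixl 7 _·_

_·_ : ℝ → ℕ → ℝ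
x · v = record
  { L           = λ q → ∃[ r ] L x r × q ℚ.< r ℚ.* ℕ→ℚ v
  ; U           = λ q → ∃[ r ] U x r × r ℚ.* ℕ→ℚ v ℚ.< q
  ; L-inhabited = let r , l = ℝ.L-inhabited x in _ , r , l , q-1<q _
  ; U-inhabited = let r , u = ℝ.U-inhabited x in _ , r , u , q<q+1 _
  ; L-down      = λ q<s (r , l , s<rv) → r , l , ℚ.<-trans q<s s<rv
  ; L-open      = λ (r , l , q<rv) → let s , q<s , s<rv = ℚ.<-dense q<rv in
                                     s , q<s , r , l , s<rv
  ; U-up        = λ q<s (r , u , rv<q) → r , u , ℚ.<-trans rv<q q<s
  ; U-open      = λ (r , u , rv<q) → let s , rv<s , s<q = ℚ.<-dense rv<q in
                                     s , s<q , r , u , rv<s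
  ; disjoint    = λ (r , l , q<rv) (r′ , u , r′v<q) →
      ℚ.<-irrefl refl (ℚ.<-≤-trans (ℚ.<-trans r′v<q q<rv)
        (ℚ.*-monoʳ-≤-nonNeg (ℕ→ℚ v) {{ℕ→ℚ-nonNeg {v}}} (ℚ.<⇒≤ (ℝ.L<U x l u))))
  ; located     = scale-located x v
  }

-- N is Fin n; the family is indexed by Fin m, repetitions being allowed.
record MaxCover : Set where
  field
    n m  : ℕ
    sets : Vec (Subset n) m
    K    : ℕ

open MaxCover public

⋃[_]_ : ∀ {n m} → Subset m → Vec (Subset n) m → Subset n
⋃[ []          ] []       = Subset.⊥
⋃[ inside  ∷ T ] (A ∷ As) = A ∪ ⋃[ T ] As
⋃[ outside ∷ T ] (A ∷ As) = ⋃[ T ] As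

-- A subfamily is a set T of indices.
coverage : (I : MaxCover) → Subset (m I) → ℕ
coverage I T = ∣ ⋃[ T ] sets I ∣

Feasible : (I : MaxCover) → Subset (m I) → Set
Feasible I T = ∣ T ∣ ≤ K I

allSubsets : ∀ k → List (Subset k)
allSubsets zero    = [] ∷ []
allSubsets (suc k) = List.map (outside ∷_) (allSubsets k)
                  ++ List.map (inside  ∷_) (allSubsets k)

feasibleSubsets : (I : MaxCover) → List (Subset (m I))
feasibleSubsets I = filter (λ T → ∣ T ∣ ℕ.≤? K I) (allSubsets (m I))

OPT : MaxCover → ℕ
OPT I = max 0 (List.map (coverage I) (feasibleSubsets I))

∈-allSubsets : ∀ {k} (T : Subset k) → T ∈ₗ allSubsets k
∈-allSubsets []            = here refl
∈-allSubsets (outside ∷ T) = ∈-++⁺ˡ (∈-map⁺ _ (∈-allSubsets T))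
∈-allSubsets (inside  ∷ T) = ∈-++⁺ʳ _ (∈-map⁺ _ (∈-allSubsets T))

coverage≤OPT : ∀ I T → Feasible I T → coverage I T ≤ OPT I
coverage≤OPT I T feasible = v≤max⁺ 0 _ (inj₂ (Any.map (λ { refl → ℕ.≤-refl })
  (∈-map⁺ (coverage I) (∈-filter⁺ (λ T → ∣ T ∣ ℕ.≤? K I) (∈-allSubsets T) feasible))))

OPT-attained : ∀ I → ∃[ T ] Feasible I T × coverage I T ≡ OPT I
OPT-attained I with argmax-sel (λ v → v) 0 (List.map (coverage I) (feasibleSubsets I))
... | inj₁ OPT≡0 = Subset.⊥ , ⊥-feasible
                 , ℕ.≤-antisym (coverage≤OPT I Subset.⊥ ⊥-feasible)
                               (subst (_≤ coverage I Subset.⊥) (sym OPT≡0) z≤n)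
  where
  ⊥-feasible : Feasible I Subset.⊥
  ⊥-feasible = subst (_≤ K I) (sym (∣⊥∣≡0 (m I))) z≤n
... | inj₂ OPT∈ = let T , T∈ , eq = ∈-map⁻ (coverage I) OPT∈ in
  T , proj₂ (∈-filter⁻ (λ T → ∣ T ∣ ℕ.≤? K I) {xs = allSubsets (m I)} T∈) , sym eq

degree : (I : MaxCover) → Fin (n I) → ℕ
degree I x = count (x ∈?_) (sets I)

IsαMaxCover : ℝ → MaxCover → Set
IsαMaxCover α I =
  Σ (ℕ.NonZero (m I)) λ m≢0 →
  ∃[ p ] (∀ x → p ≤ degree I x) × α ≤ᴿ fromℚ (ℚ._/_ (+ p) (m I) {{m≢0}})

-- Model of computation: Jones's WHILE language.
--
-- Data are binary trees, and each basic tree operation takes one unit of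
-- time (trees are immutable and shared, so cons copies two pointers).
-- Polynomial time in this model coincides with polynomial time on Turing
-- machines (N. D. Jones, "Computability and Complexity from a Programming
-- Perspective", MIT Press, 1997).

data Tree : Set where
  nil  : Tree
  cons : Tree → Tree → Tree

size : Tree → ℕ
size nil        = 1
size (cons s t) = suc (size s + size t)

head tail : Tree → Tree
head nil        = nil
head (cons s t) = s
tail nil        = nil
tail (cons s t) = t

data Expr (k : ℕ) : Set where
  var   : Fin k → Expr k
  nil   : Expr k
  cons  : Expr k → Expr k → Expr k
  hd tl : Expr k → Expr k

infix  6 _:=_
infixr 5 _⨾_

data Cmd (k : ℕ) : Set where
  _:=_          : Fin k → Expr k → Cmd k
  _⨾_           : Cmd k → Cmd k → Cmd k
  if_then_else_ : Expr k → Cmd k → Cmd k → Cmd k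
  while_run_    : Expr k → Cmd k → Cmd k

Store : ℕ → Set
Store = Vec Tree

eval : ∀ {k} → Expr k → Store k → Tree
eval (var x)    σ = lookup σ x
eval nil        σ = nil
eval (cons e f) σ = cons (eval e σ) (eval f σ)
eval (hd e)     σ = head (eval e σ)
eval (tl e)     σ = tail (eval e σ)

cost : ∀ {k} → Expr k → ℕ
cost (var x)    = 1
cost nil        = 1
cost (cons e f) = suc (cost e + cost f)
cost (hd e)     = suc (cost e)
cost (tl e)     = suc (cost e)

infix 4 ⟨_,_⟩⇓[_]_

-- ⟨ c , σ ⟩⇓[ t ] τ : started in σ, command c halts in τ after time t.
-- A condition is true when it is not nil.
data ⟨_,_⟩⇓[_]_ {k : ℕ} : Cmd k → Store k → ℕ → Store k → Set where
  assign : ∀ {x e σ} →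
    ⟨ x := e , σ ⟩⇓[ suc (cost e) ] (σ [ x ]≔ eval e σ)
  seq : ∀ {c d σ τ υ s t} →
    ⟨ c , σ ⟩⇓[ s ] τ → ⟨ d , τ ⟩⇓[ t ] υ →
    ⟨ c ⨾ d , σ ⟩⇓[ suc (s + t) ] υ
  if-true : ∀ {e c d σ τ t a b} → eval e σ ≡ cons a b →
    ⟨ c , σ ⟩⇓[ t ] τ →
    ⟨ if e then c else d , σ ⟩⇓[ suc (cost e + t) ] τ
  if-false : ∀ {e c d σ τ t} → eval e σ ≡ nil →
    ⟨ d , σ ⟩⇓[ t ] τ →
    ⟨ if e then c else d , σ ⟩⇓[ suc (cost e + t) ] τ
  while-true : ∀ {e c σ τ υ s t a b} → eval e σ ≡ cons a b →
    ⟨ c , σ ⟩⇓[ s ] τ → ⟨ while e run c , τ ⟩⇓[ t ] υ →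
    ⟨ while e run c , σ ⟩⇓[ suc (cost e + s + t) ] υ
  while-false : ∀ {e c σ} → eval e σ ≡ nil →
    ⟨ while e run c , σ ⟩⇓[ suc (cost e) ] σ

-- Variable zero holds the input at the start and the output at the end;
-- the other variables are initially nil.
record Program : Set where
  field
    extraVars : ℕ
    body      : Cmd (suc extraVars)

_on_⇒_within_ : Program → Tree → Tree → ℕ → Set
P on d ⇒ d′ within b =
  ∃[ t ] ∃[ τ ] ⟨ body , d ∷ Vec.replicate extraVars nil ⟩⇓[ t ] τ
                × lookup τ zero ≡ d′ × t ≤ b
  where open Program P

encodeList : List Tree → Tree
encodeList = List.foldr cons nil

encodeBool : Bool → Tree
encodeBool false = nil
encodeBool true  = cons nil nil

encodeSubset : ∀ {k} → Subset k → Tree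
encodeSubset T = encodeList (List.map encodeBool (Vec.toList T))

-- K is written in binary, least significant digit first (with the digits
-- 1 and 2 of ℕᵇ), so that its length is logarithmic in K.
encodeℕᵇ : ℕᵇ → Tree
encodeℕᵇ ℕᵇ.zero  = nil
encodeℕᵇ 2[1+ b ] = cons (encodeBool false) (encodeℕᵇ b)
encodeℕᵇ 1+[2 b ] = cons (encodeBool true) (encodeℕᵇ b)

-- K, followed by the m × n incidence matrix of the family.
encode : MaxCover → Tree
encode I = cons (encodeℕᵇ (fromℕ (K I)))
                (encodeList (List.map encodeSubset (Vec.toList (sets I))))

-- P runs in polynomial time on the instances in C, and returns at most K
-- sets that together cover at least β · OPT elements.
PolyTimeApproximates : ℝ → (MaxCover → Set) → Program → Set
PolyTimeApproximates β C P =
  ∃[ c ] ∃[ k ] ∀ I → C I →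
    ∃[ T ] (P on encode I ⇒ encodeSubset T within (c * size (encode I) ^ k + c))
           × Feasible I T
           × β · OPT I ≤ᴿ fromℕᴿ (coverage I T)

HasPTAS : (MaxCover → Set) → Set₁
HasPTAS C = ∀ β → 0ᴿ <ᴿ β → β <ᴿ 1ᴿ → ∃[ P ] PolyTimeApproximates β C P

{-# OPTIONS --safe #-}

-- The algorithm tries all subfamilies of at most min(K, K₀) sets, for a constant K₀, and keeps the best.
-- If K ≤ K₀ this is optimal.  Otherwise compare with the greedy choice of K₀ sets: if every element lies in
-- at least a fraction 1/(1 + a) of the sets, then an average set covers that fraction of the uncovered
-- elements, and some set does at least as well.  After k greedy steps at most (a/(1 + a))^k · n
-- elements are uncovered, and by Bernoulli's inequality k = a d makes this at most n/(1 + d).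
-- There are at most (1 + m)^K₀ subfamilies to try, so the running time is polynomial.
module Submission where

open import Defs
import Data.Bool.Base as Bool
open import Data.Bool.Base using (true; false; T)
open import Data.Fin.Base using (Fin; zero; suc)
open import Data.Fin using (#_)
open import Data.Fin.Subset as Subset using (Subset; inside; outside; ∁; _∩_; _∪_; _⊆_; _∈_; ∣_∣)
open import Data.Fin.Subset.Properties
  using (_∈?_; p⊆q⇒∣p∣≤∣q∣; x∈p∪q⁺; x∈p∪q⁻; ∣∁p∣≡n∸∣p∣; ∣p∣≤n; ∪-assoc; ∪-comm; ∣⊥∣≡0)
open import Data.Integer.Base as ℤ using (+≤+; +<+)
import Data.Integer.Properties as ℤ
open import Data.List.Base as List using (List; []; _∷_; length; _ʳ++_)
import Data.List.Properties as List
open import Data.List.Membership.Propositional using () renaming (_∈_ to _∈ₗ_)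
open import Data.List.Relation.Unary.All as All using (All; []; _∷_)
open import Data.List.Relation.Unary.Any using (here; there)
open import Data.Nat.Base as ℕ using (ℕ; zero; suc; _+_; _*_; _∸_; _^_; _≤_; _<_; z≤n; s≤s; NonZero)
import Data.Nat.Properties as ℕ
open import Data.Nat.Binary.Base using (ℕᵇ; 2[1+_]; 1+[2_]; fromℕ)
import Data.Nat.Binary.Properties as ℕᵇ
open import Data.Nat.Tactic.RingSolver using (solve-∀)
open import Data.Product.Base using (∃-syntax; _×_; _,_; proj₁; proj₂)
open import Data.Rational.Base as ℚ using (mkℚ; toℚᵘ)
import Data.Rational.Properties as ℚ
open import Data.Rational.Unnormalised.Base as ℚᵘ using (mkℚᵘ)
import Data.Rational.Unnormalised.Properties as ℚᵘ
open import Data.Sum.Base using (_⊎_; inj₁; inj₂)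
open import Data.Vec.Base as Vec using (Vec; []; _∷_; lookup; count; _[_]≔_)
import Data.Vec.Properties as Vec
open import Function.Base using (_∘_)
open import Relation.Binary.PropositionalEquality
  using (_≡_; _≢_; refl; sym; trans; cong; cong₂; subst; subst₂)
open import Relation.Nullary using (does)

-- The program never makes the greedy choice. Greed only shows that some family of `K₀` sets covers
-- a fraction `d/(1 + d)` of all `n` elements, and `n` bounds `OPT`; hence optimal families need no
-- analysis when `K` exceeds `K₀`. The real parameters are given as cuts. They are replaced by
-- rationals, `1/(1 + a)` below `α` and `d/(1 + d)` above `β`, and from then on every inequality
-- lives in `ℕ` with denominators cleared. Both enter the program only through the constant `K₀`. On
-- the side of the machine, `K` is written in binary and may be exponential in the input size, so it
-- is only compared with the constants below `K₀`. Trees offer no arithmetic: counters are unary,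
-- subsets are lists of bits, and every candidate carries its remaining budget and its union.

private variable
  N : ℕ

-- The greedy bound

+-swap : ∀ i j k → i + (j + k) ≡ j + (i + k)
+-swap = solve-∀

*-swap : ∀ i j k → i * (j * k) ≡ j * (i * k)
*-swap = solve-∀

∑∈ : Subset N → (Fin N → ℕ) → ℕ
∑∈ []            f = 0
∑∈ (inside  ∷ V) f = f zero + ∑∈ V (f ∘ suc)
∑∈ (outside ∷ V) f = ∑∈ V (f ∘ suc)

∑∈-lowerBound : ∀ (V : Subset N) {f p} → (∀ x → p ≤ f x) → ∣ V ∣ * p ≤ ∑∈ V f
∑∈-lowerBound []            p≤f = z≤n
∑∈-lowerBound (inside  ∷ V) p≤f = ℕ.+-mono-≤ (p≤f zero) (∑∈-lowerBound V (p≤f ∘ suc))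
∑∈-lowerBound (outside ∷ V) p≤f = ∑∈-lowerBound V (p≤f ∘ suc)

∑∈-zero : ∀ (V : Subset N) → ∑∈ V (λ _ → 0) ≡ 0
∑∈-zero []            = refl
∑∈-zero (inside  ∷ V) = ∑∈-zero V
∑∈-zero (outside ∷ V) = ∑∈-zero V

-- The conditional is what `count (x ∈?_)` unfolds to at a family with first set `A`.
∑∈-count : ∀ (V A : Subset N) f →
  ∑∈ V (λ x → (Bool.if does (x ∈? A) then suc else (λ k → k)) (f x)) ≡ ∣ V ∩ A ∣ + ∑∈ V f
∑∈-count []            []            f = refl
∑∈-count (inside  ∷ V) (inside  ∷ A) f = cong suc (trans
  (cong (f zero +_) (∑∈-count V A (f ∘ suc)))
  (+-swap (f zero) ∣ V ∩ A ∣ (∑∈ V (f ∘ suc))))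
∑∈-count (inside  ∷ V) (outside ∷ A) f = trans
  (cong (f zero +_) (∑∈-count V A (f ∘ suc)))
  (+-swap (f zero) ∣ V ∩ A ∣ (∑∈ V (f ∘ suc)))
∑∈-count (outside ∷ V) (_ ∷ A) f = ∑∈-count V A (f ∘ suc)

-- Double counting of the pairs of an element of `V` and a set containing it.
∑-degree : ∀ {m} (V : Subset N) (As : Vec (Subset N) m) →
  ∑∈ V (λ x → count (x ∈?_) As) ≡ Vec.sum (Vec.map (λ A → ∣ V ∩ A ∣) As)
∑-degree V []       = ∑∈-zero V
∑-degree V (A ∷ As) = trans (∑∈-count V A _) (cong (∣ V ∩ A ∣ +_) (∑-degree V As))

average≤some : ∀ {a} {A : Set a} (f : A → ℕ) {m} (xs : Vec A (suc m)) →
  ∃[ j ] Vec.sum (Vec.map f xs) ≤ suc m * f (lookup xs j)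
average≤some f (x ∷ []) = zero , ℕ.≤-refl
average≤some f {suc m} (x ∷ xs@(_ ∷ _)) with average≤some f xs
... | j , h with ℕ.≤-total (f x) (f (lookup xs j))
...   | inj₁ le = suc j , ℕ.+-mono-≤ le h
...   | inj₂ ge = zero , ℕ.+-monoʳ-≤ (f x) (ℕ.≤-trans h (ℕ.*-monoʳ-≤ (suc m) ge))

∣p∪q∣≡∣p∣+∣∁p∩q∣ : ∀ (p q : Subset N) → ∣ p ∪ q ∣ ≡ ∣ p ∣ + ∣ ∁ p ∩ q ∣
∣p∪q∣≡∣p∣+∣∁p∩q∣ []            []            = refl
∣p∪q∣≡∣p∣+∣∁p∩q∣ (inside  ∷ p) (_       ∷ q) = cong suc (∣p∪q∣≡∣p∣+∣∁p∩q∣ p q)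
∣p∪q∣≡∣p∣+∣∁p∩q∣ (outside ∷ p) (inside  ∷ q) =
  trans (cong suc (∣p∪q∣≡∣p∣+∣∁p∩q∣ p q)) (sym (ℕ.+-suc ∣ p ∣ _))
∣p∪q∣≡∣p∣+∣∁p∩q∣ (outside ∷ p) (outside ∷ q) = ∣p∪q∣≡∣p∣+∣∁p∩q∣ p q

∣∁p∣+∣p∣≡n : ∀ (p : Subset N) → ∣ ∁ p ∣ + ∣ p ∣ ≡ N
∣∁p∣+∣p∣≡n p = trans (cong (_+ ∣ p ∣) (∣∁p∣≡n∸∣p∣ p)) (ℕ.m∸n+n≡m (∣p∣≤n p))

-- Only an inequality, because `j` may already be in `T`. The greedy choice does not exclude this;
-- it happens only when nothing is uncovered.
∣insert∣ : ∀ {m} (T : Subset m) j → ∣ T [ j ]≔ inside ∣ ≤ suc ∣ T ∣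
∣insert∣ (inside  ∷ T) zero    = ℕ.n≤1+n _
∣insert∣ (outside ∷ T) zero    = ℕ.≤-refl
∣insert∣ (inside  ∷ T) (suc j) = s≤s (∣insert∣ T j)
∣insert∣ (outside ∷ T) (suc j) = ∣insert∣ T j

⋃-insert : ∀ {m} (T : Subset m) (As : Vec (Subset N) m) j →
  ⋃[ T ] As ∪ lookup As j ⊆ ⋃[ T [ j ]≔ inside ] As
⋃-insert (inside ∷ T) (A ∷ As) zero x∈ with x∈p∪q⁻ (A ∪ ⋃[ T ] As) A x∈
... | inj₁ x∈U = x∈U
... | inj₂ x∈A = x∈p∪q⁺ (inj₁ x∈A)
⋃-insert (outside ∷ T) (A ∷ As) zero {x} x∈ = subst (x ∈_) (∪-comm (⋃[ T ] As) A) x∈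
⋃-insert (inside ∷ T) (A ∷ As) (suc j) {x} x∈
  with x∈p∪q⁻ A (⋃[ T ] As ∪ lookup As j) (subst (x ∈_) (∪-assoc A (⋃[ T ] As) (lookup As j)) x∈)
... | inj₁ x∈A = x∈p∪q⁺ (inj₁ x∈A)
... | inj₂ x∈U = x∈p∪q⁺ (inj₂ (⋃-insert T As j x∈U))
⋃-insert (outside ∷ T) (A ∷ As) (suc j) = ⋃-insert T As j

uncovered : ∀ {m} → Vec (Subset N) m → Subset m → ℕ
uncovered As T = ∣ ∁ (⋃[ T ] As) ∣

greedy-step : ∀ {m} (As : Vec (Subset N) (suc m)) {a p} →
  (∀ x → p ≤ count (x ∈?_) As) → suc m ≤ suc a * p → ∀ T →
  ∃[ j ] suc a * uncovered As (T [ j ]≔ inside) ≤ a * uncovered As T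
greedy-step {N} {m} As {a} {p} p≤deg m≤ap T
  with j , avg ← average≤some (λ A → ∣ ∁ (⋃[ T ] As) ∩ A ∣) As = j , shrinks
  where
  open ℕ.≤-Reasoning
  X X′ : Subset N
  X  = ⋃[ T ] As
  X′ = ⋃[ T [ j ]≔ inside ] As
  u u′ c f : ℕ
  u  = ∣ ∁ X ∣
  u′ = ∣ ∁ X′ ∣
  c  = ∣ X ∣
  f  = ∣ ∁ X ∩ lookup As j ∣

  -- The chosen set meets at least the average number of uncovered elements, and that average is at
  -- least `u * p / suc m`.
  gain : u ≤ suc a * f
  gain = ℕ.*-cancelˡ-≤ (suc m) (begin
    suc m * u          ≤⟨ ℕ.*-monoˡ-≤ u m≤ap ⟩
    suc a * p * u      ≡⟨ rearrange (suc a) p u ⟩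
    suc a * (u * p)    ≤⟨ ℕ.*-monoʳ-≤ (suc a) (∑∈-lowerBound (∁ X) p≤deg) ⟩
    suc a * _          ≡⟨ cong (suc a *_) (∑-degree (∁ X) As) ⟩
    suc a * _          ≤⟨ ℕ.*-monoʳ-≤ (suc a) avg ⟩
    suc a * (suc m * f) ≡⟨ *-swap (suc a) (suc m) f ⟩
    suc m * (suc a * f) ∎)
    where
    rearrange : ∀ x y z → x * y * z ≡ x * (z * y)
    rearrange = solve-∀

  -- Adding `c` turns a claim about complements into one about unions, since covered and uncovered
  -- elements sum to `N` before and after the insertion.
  lost : u′ + f ≤ u
  lost = ℕ.+-cancelʳ-≤ c _ _ (begin
    u′ + f + c           ≡⟨ ℕ.+-assoc u′ f c ⟩
    u′ + (f + c)         ≡⟨ cong (u′ +_) (ℕ.+-comm f c) ⟩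
    u′ + (c + f)         ≡⟨ cong (u′ +_) (∣p∪q∣≡∣p∣+∣∁p∩q∣ X (lookup As j)) ⟨
    u′ + ∣ X ∪ lookup As j ∣ ≤⟨ ℕ.+-monoʳ-≤ u′ (p⊆q⇒∣p∣≤∣q∣ (⋃-insert T As j)) ⟩
    u′ + ∣ X′ ∣              ≡⟨ ∣∁p∣+∣p∣≡n X′ ⟩
    N                              ≡⟨ ∣∁p∣+∣p∣≡n X ⟨
    u + c                      ∎)

  shrinks : suc a * u′ ≤ a * u
  shrinks = ℕ.+-cancelʳ-≤ u _ _ (begin
    suc a * u′ + u         ≤⟨ ℕ.+-monoʳ-≤ (suc a * u′) gain ⟩
    suc a * u′ + suc a * f ≡⟨ ℕ.*-distribˡ-+ (suc a) u′ f ⟨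
    suc a * (u′ + f)       ≤⟨ ℕ.*-monoʳ-≤ (suc a) lost ⟩
    u + a * u                    ≡⟨ ℕ.+-comm u (a * u) ⟩
    a * u + u                    ∎)

greedy : ∀ {m} (As : Vec (Subset N) (suc m)) {a p} →
  (∀ x → p ≤ count (x ∈?_) As) → suc m ≤ suc a * p → ∀ k →
  ∃[ T ] ∣ T ∣ ≤ k × suc a ^ k * uncovered As T ≤ a ^ k * N
greedy {m = m} As _ _ zero =
  Subset.⊥ , ℕ.≤-reflexive (∣⊥∣≡0 (suc m))
           , ℕ.+-monoˡ-≤ 0 (∣p∣≤n (∁ (⋃[ Subset.⊥ ] As)))
greedy {N} As {a} p≤deg m≤ap (suc k)
  with T , ∣T∣≤k , h ← greedy As p≤deg m≤ap k
  with j , shrinks ← greedy-step As {a} p≤deg m≤ap T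
  = T [ j ]≔ inside , ℕ.≤-trans (∣insert∣ T j) (s≤s ∣T∣≤k) , (begin
    suc a * suc a ^ k * u′    ≡⟨ rearrange (suc a) (suc a ^ k) u′ ⟩
    suc a ^ k * (suc a * u′)  ≤⟨ ℕ.*-monoʳ-≤ (suc a ^ k) shrinks ⟩
    suc a ^ k * (a * u)       ≡⟨ *-swap (suc a ^ k) a u ⟩
    a * (suc a ^ k * u)       ≤⟨ ℕ.*-monoʳ-≤ a h ⟩
    a * (a ^ k * N)           ≡⟨ ℕ.*-assoc a (a ^ k) N ⟨
    a * a ^ k * N             ∎)
  where
  open ℕ.≤-Reasoning
  u u′ : ℕ
  u  = uncovered As T
  u′ = uncovered As (T [ j ]≔ inside)
  rearrange : ∀ x y z → x * y * z ≡ y * (x * z)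
  rearrange = solve-∀

-- This is `(1 + 1/a)^k ≥ 1 + k/a` multiplied by `a^(k + 1)`.
bernoulli : ∀ a k → a ^ k * (a + k) ≤ a * suc a ^ k
bernoulli a zero    = ℕ.≤-reflexive (base a)
  where
  base : ∀ a → 1 * (a + 0) ≡ a * 1
  base = solve-∀
bernoulli a (suc k) = begin
  -- The added term is the quadratic one that the usual induction drops.
  a * a ^ k * (a + suc k)                 ≤⟨ ℕ.m≤m+n _ (a ^ k * k) ⟩
  a * a ^ k * (a + suc k) + a ^ k * k     ≡⟨ regroup a (a ^ k) k ⟩
  suc a * (a ^ k * (a + k))               ≤⟨ ℕ.*-monoʳ-≤ (suc a) (bernoulli a k) ⟩
  suc a * (a * suc a ^ k)                 ≡⟨ *-swap (suc a) a (suc a ^ k) ⟩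
  a * (suc a * suc a ^ k)                 ∎
  where
  open ℕ.≤-Reasoning
  regroup : ∀ x y k → x * y * (x + suc k) + y * k ≡ suc x * (y * (x + k))
  regroup = solve-∀

few-sets-suffice : ∀ {m} (As : Vec (Subset N) (suc m)) a d .{{_ : NonZero a}} {p} →
  (∀ x → p ≤ count (x ∈?_) As) → suc m ≤ suc a * p →
  ∃[ T ] ∣ T ∣ ≤ a * d × d * N ≤ suc d * ∣ ⋃[ T ] As ∣
few-sets-suffice {N} As a d p≤deg m≤ap
  with T , ∣T∣≤k , h ← greedy As {a} p≤deg m≤ap (a * d)
  = T , ∣T∣≤k , covered T h
  where
  open ℕ.≤-Reasoning
  k : ℕ
  k = a * d

  -- The choice `k = a * d` makes `a + k` equal to `a * suc d`, and the factor `a` cancels.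
  power : a ^ k * suc d ≤ suc a ^ k
  power = ℕ.*-cancelˡ-≤ a (begin
    a * (a ^ k * suc d) ≡⟨ regroup a (a ^ k) d ⟩
    a ^ k * (a + a * d) ≤⟨ bernoulli a k ⟩
    a * suc a ^ k       ∎)
    where
    regroup : ∀ x y d → x * (y * suc d) ≡ y * (x + x * d)
    regroup = solve-∀

  module _ T (h : suc a ^ k * uncovered As T ≤ a ^ k * N) where
    u c : ℕ
    u = uncovered As T
    c = ∣ ⋃[ T ] As ∣

    few-uncovered : suc d * u ≤ N
    few-uncovered = ℕ.*-cancelˡ-≤ (a ^ k) {{ℕ.m^n≢0 a k}} (begin
      a ^ k * (suc d * u)   ≡⟨ ℕ.*-assoc (a ^ k) (suc d) u ⟨
      a ^ k * suc d * u     ≤⟨ ℕ.*-monoˡ-≤ u power ⟩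
      suc a ^ k * u         ≤⟨ h ⟩
      a ^ k * N             ∎)

    covered : d * N ≤ suc d * c
    covered = ℕ.+-cancelˡ-≤ N _ _ (begin
      suc d * N             ≡⟨ cong (suc d *_) (∣∁p∣+∣p∣≡n (⋃[ T ] As)) ⟨
      suc d * (u + c)       ≡⟨ ℕ.*-distribˡ-+ (suc d) u c ⟩
      suc d * u + suc d * c ≤⟨ ℕ.+-monoˡ-≤ (suc d * c) few-uncovered ⟩
      N + suc d * c         ∎)

-- Natural numbers from the real parameters

-- The cut gives a rational `num/(1 + d)` strictly between `β` and 1. Since `num` is an integer,
-- `num < 1 + d` means `num ≤ d`, so `β` lies below `d/(1 + d)`.
·≤-fromℕ : ∀ β → β <ᴿ 1ᴿ →
  ∃[ d ] ∀ x y → d * x ≤ suc d * y → β · x ≤ᴿ fromℕᴿ y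
·≤-fromℕ β (q@(mkℚ num d _) , β<q , q<1) = d , λ x y h p (r , r<β , p<rx) →
  ℚ.<-≤-trans p<rx (ℚ.≤-trans
    (ℚ.*-monoʳ-≤-nonNeg (ℕ→ℚ x) {{ℚ.normalize-nonNeg x 1}} (ℚ.<⇒≤ (ℝ.L<U β r<β β<q)))
    (scaled x y h))
  where
  num≤d : num ℤ.≤ ℤ.+ d
  num≤d = ℤ.i<j⇒i≤pred[j] (subst₂ ℤ._<_ (ℤ.*-identityʳ num) (ℤ.*-identityˡ (ℤ.+ suc d))
            (ℚ.drop-*<* q<1))

  scaled : ∀ x y → d * x ≤ suc d * y → q ℚ.* ℕ→ℚ x ℚ.≤ ℕ→ℚ y
  scaled x y h = ℚ.toℚᵘ-cancel-≤ (begin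
    toℚᵘ (q ℚ.* ℕ→ℚ x)         ≃⟨ ℚ.toℚᵘ-homo-* q (ℕ→ℚ x) ⟩
    toℚᵘ q ℚᵘ.* toℚᵘ (ℕ→ℚ x)   ≃⟨ ℚᵘ.*-congˡ {toℚᵘ q} (ℚ.toℚᵘ-fromℚᵘ (mkℚᵘ (ℤ.+ x) 0)) ⟩
    toℚᵘ q ℚᵘ.* mkℚᵘ (ℤ.+ x) 0 ≤⟨ ℚᵘ.*≤* cross ⟩
    mkℚᵘ (ℤ.+ y) 0             ≃⟨ ℚ.toℚᵘ-fromℚᵘ (mkℚᵘ (ℤ.+ y) 0) ⟨
    toℚᵘ (ℕ→ℚ y)               ∎)
    where
    open ℚᵘ.≤-Reasoning
    cross : num ℤ.* ℤ.+ x ℤ.* ℤ.+ 1 ℤ.≤ ℤ.+ y ℤ.* ℤ.+ (suc d * 1)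
    cross = subst₂ ℤ._≤_ (sym (ℤ.*-identityʳ (num ℤ.* ℤ.+ x)))
      (trans (ℤ.pos-* (suc d) y)
        (trans (ℤ.*-comm (ℤ.+ suc d) (ℤ.+ y)) (cong (λ k → ℤ.+ y ℤ.* ℤ.+ k) (sym (ℕ.*-identityʳ (suc d))))))
      (ℤ.≤-trans (ℤ.*-monoʳ-≤-nonNeg (ℤ.+ x) num≤d)
        (subst (ℤ._≤ ℤ.+ (suc d * y)) (ℤ.pos-* d x) (+≤+ h)))

-- The cut gives a rational `num/(1 + a)` strictly between 0 and `α`. Its numerator is at least 1,
-- so `1/(1 + a)` lies below every `p/m` that bounds `α` from above.
≤-fraction : ∀ α → 0ᴿ <ᴿ α →
  ∃[ a ] ∀ p m {{_ : NonZero m}} → α ≤ᴿ fromℚ (ℤ.+ p ℚ./ m) → m ≤ suc a * p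
≤-fraction α (q@(mkℚ num a _) , 0<q , q<α) = a , bound
  where
  0<num : ℤ.+ 0 ℤ.< num
  0<num = subst (ℤ.+ 0 ℤ.<_) (ℤ.*-identityʳ num) (ℚ.drop-*<* 0<q)

  numerator : ∀ {i} → ℤ.+ 0 ℤ.< i → ∀ m k → i ℤ.* ℤ.+ m ℤ.< ℤ.+ k → m ≤ k
  numerator (+<+ {n = suc i} _) m k h with subst (ℤ._< ℤ.+ k) (sym (ℤ.pos-* (suc i) m)) h
  ... | +<+ im<k = ℕ.≤-trans (ℕ.m≤m+n m (i * m)) (ℕ.<⇒≤ im<k)

  bound : ∀ p m {{_ : NonZero m}} → α ≤ᴿ fromℚ (ℤ.+ p ℚ./ m) → m ≤ suc a * p
  bound p m@(suc m-1) α≤p/m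
    with ℚᵘ.*<* h ← ℚᵘ.<-respʳ-≃ (ℚ.toℚᵘ-fromℚᵘ (mkℚᵘ (ℤ.+ p) m-1)) (ℚ.toℚᵘ-mono-< (α≤p/m q q<α))
    = numerator 0<num m (suc a * p)
        (subst (num ℤ.* ℤ.+ m ℤ.<_) (trans (ℤ.*-comm (ℤ.+ p) (ℤ.+ suc a)) (sym (ℤ.pos-* (suc a) p))) h)

-- Timed runs of commands

infix 4 _⊢⟨_,_⟩⇓[_]_

-- The weight w is kept apart from the factor a, so that the factors of straight-line code are numerals.
record _⊢⟨_,_⟩⇓[_]_ {k} (w : ℕ) (c : Cmd k) (σ : Store k) (a : ℕ) (τ : Store k) : Set where
  constructor run
  field
    {time}     : ℕ
    derivation : ⟨ c , σ ⟩⇓[ time ] τ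
    time≤      : time ≤ a * w

module _ {k : ℕ} {w : ℕ} where

  reweigh : ∀ {c : Cmd k} {σ τ a w′} → w ≤ w′ → w ⊢⟨ c , σ ⟩⇓[ a ] τ → w′ ⊢⟨ c , σ ⟩⇓[ a ] τ
  reweigh {a = a} w≤w′ (run r t≤) = run r (ℕ.≤-trans t≤ (ℕ.*-monoʳ-≤ a w≤w′))

  weaken : ∀ {c : Cmd k} {σ τ a b} → a ≤ b → w ⊢⟨ c , σ ⟩⇓[ a ] τ → w ⊢⟨ c , σ ⟩⇓[ b ] τ
  weaken a≤b (run r t≤) = run r (ℕ.≤-trans t≤ (ℕ.*-monoˡ-≤ w a≤b))

  relax : ∀ {c : Cmd k} {σ τ a b} {_ : T (a ℕ.≤ᵇ b)} →
    w ⊢⟨ c , σ ⟩⇓[ a ] τ → w ⊢⟨ c , σ ⟩⇓[ b ] τ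
  relax {a = a} {b} {a≤b} = weaken (ℕ.≤ᵇ⇒≤ a b a≤b)

  -- For a loop of l ≤ N rounds, the number of rounds moves from the factor into the weight.
  iterations : ∀ {c : Cmd k} {σ τ l a b w′} N .{{_ : NonZero N}} → l ≤ N → N * w ≤ w′ →
    w ⊢⟨ c , σ ⟩⇓[ l * a + b ] τ → w′ ⊢⟨ c , σ ⟩⇓[ a + b ] τ
  iterations {l = l} {a} {b} {w′} N l≤N Nw≤w′ (run {t} r t≤) = run r (begin
    t                     ≤⟨ t≤ ⟩
    (l * a + b) * w       ≤⟨ ℕ.*-monoˡ-≤ w (ℕ.+-mono-≤ (ℕ.*-monoˡ-≤ a l≤N) (ℕ.m≤n*m b N)) ⟩
    (N * a + N * b) * w   ≡⟨ regroup N a b w ⟩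
    (a + b) * (N * w)     ≤⟨ ℕ.*-monoʳ-≤ (a + b) Nw≤w′ ⟩
    (a + b) * w′          ∎)
    where
    open ℕ.≤-Reasoning
    regroup : ∀ N a b w → (N * a + N * b) * w ≡ (a + b) * (N * w)
    regroup = solve-∀

  module _ .{{_ : NonZero w}} where

    private
      tick : ∀ {s} j a → s ≤ a * w → j + s ≤ (j + a) * w
      tick {s} j a s≤ = ℕ.≤-trans (ℕ.+-mono-≤ (ℕ.m≤m*n j w) s≤) (ℕ.≤-reflexive (sym (ℕ.*-distribʳ-+ w j a)))

      both : ∀ {s t} a b → s ≤ a * w → t ≤ b * w → s + t ≤ (a + b) * w
      both a b s≤ t≤ = ℕ.≤-trans (ℕ.+-mono-≤ s≤ t≤) (ℕ.≤-reflexive (sym (ℕ.*-distribʳ-+ w a b)))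

    set : ∀ {x} {e : Expr k} {σ} → w ⊢⟨ x := e , σ ⟩⇓[ suc (cost e) ] (σ [ x ]≔ eval e σ)
    set {e = e} = run assign (ℕ.m≤m*n (suc (cost e)) w)

    infixr 5 _▸_

    _▸_ : ∀ {c d : Cmd k} {σ τ υ a b} →
      w ⊢⟨ c , σ ⟩⇓[ a ] τ → w ⊢⟨ d , τ ⟩⇓[ b ] υ → w ⊢⟨ c ⨾ d , σ ⟩⇓[ suc (a + b) ] υ
    _▸_ {a = a} {b} (run r s≤) (run r′ t≤) = run (seq r r′) (tick 1 (a + b) (both a b s≤ t≤))

    then-run : ∀ {e} {c d : Cmd k} {σ τ a s t} → eval e σ ≡ cons s t →
      w ⊢⟨ c , σ ⟩⇓[ a ] τ → w ⊢⟨ if e then c else d , σ ⟩⇓[ suc (cost e + a) ] τ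
    then-run {e} {a = a} eq (run r t≤) = run (if-true eq r) (tick (suc (cost e)) a t≤)

    else-run : ∀ {e} {c d : Cmd k} {σ τ a} → eval e σ ≡ nil →
      w ⊢⟨ d , σ ⟩⇓[ a ] τ → w ⊢⟨ if e then c else d , σ ⟩⇓[ suc (cost e + a) ] τ
    else-run {e} {a = a} eq (run r t≤) = run (if-false eq r) (tick (suc (cost e)) a t≤)

    iterate : ∀ {e} {c : Cmd k} {σ τ υ a b s t} → eval e σ ≡ cons s t →
      w ⊢⟨ c , σ ⟩⇓[ a ] τ → w ⊢⟨ while e run c , τ ⟩⇓[ b ] υ →
      w ⊢⟨ while e run c , σ ⟩⇓[ suc (cost e + a + b) ] υ
    iterate {e} {a = a} {b} eq (run r s≤) (run r′ t≤) =
      run (while-true eq r r′) (both (suc (cost e + a)) b (tick (suc (cost e)) a s≤) t≤)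

    stop : ∀ {e} {c : Cmd k} {σ} → eval e σ ≡ nil → w ⊢⟨ while e run c , σ ⟩⇓[ suc (cost e) ] σ
    stop {e} eq = run (while-false eq) (ℕ.m≤m*n (suc (cost e)) w)

-- Building blocks of the program: comparison with a constant, reversal, union

-- The language tests only for `nil`. Equality with a tree fixed in advance is unrolled into nested
-- tests, so its cost does not depend on the input.
ifEq : ∀ {k} → Expr k → Tree → Cmd k → Cmd k → Cmd k
ifEq e nil        c d = if e then d else c
ifEq e (cons s t) c d = if e then ifEq (hd e) s (ifEq (tl e) t c d) d else d

ifEqCost : ∀ {k} → Expr k → Tree → ℕ → ℕ
ifEqCost e nil        a = suc (cost e + a)
ifEqCost e (cons s t) a = suc (cost e + ifEqCost (hd e) s (ifEqCost (tl e) t a))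

≤-ifEqCost : ∀ {k} (e : Expr k) s a → a ≤ ifEqCost e s a
≤-ifEqCost e nil        a = ℕ.m≤n+m a (suc (cost e))
≤-ifEqCost e (cons s t) a = ℕ.≤-trans (≤-ifEqCost (tl e) t a)
  (ℕ.≤-trans (≤-ifEqCost (hd e) s _) (ℕ.m≤n+m _ (suc (cost e))))

-- The tests on the tail run inside the success branch of those on the head, so the induction needs
-- arbitrary branches and an arbitrary postcondition `Q`.
ifEq-run : ∀ {k w} .{{_ : NonZero w}} (e : Expr k) s {c d σ a} {Q : Store k → Set} →
  (eval e σ ≡ s → ∃[ τ ] w ⊢⟨ c , σ ⟩⇓[ a ] τ × Q τ) →
  (eval e σ ≢ s → ∃[ τ ] w ⊢⟨ d , σ ⟩⇓[ a ] τ × Q τ) →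
  ∃[ τ ] w ⊢⟨ ifEq e s c d , σ ⟩⇓[ ifEqCost e s a ] τ × Q τ
ifEq-run e nil {σ = σ} yes-run no-run with eval e σ in eq
... | nil      = let τ , r , q = yes-run refl in τ , else-run eq r , q
... | cons _ _ = let τ , r , q = no-run λ () in τ , then-run eq r , q
ifEq-run {k} {w} e (cons s t) {c} {d} {σ} {a} {Q} yes-run no-run = go (eval e σ) refl
  where
  inner : ℕ
  inner = ifEqCost (tl e) t a

  go : ∀ u → eval e σ ≡ u → ∃[ τ ] w ⊢⟨ ifEq e (cons s t) c d , σ ⟩⇓[ ifEqCost e (cons s t) a ] τ × Q τ
  go nil eq =
    let τ , r , q = no-run (λ e≡ → case (trans (sym eq) e≡))
    in τ , else-run eq (weaken (ℕ.≤-trans (≤-ifEqCost (tl e) t a) (≤-ifEqCost (hd e) s inner)) r) , q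
    where
    case : nil ≢ cons s t
    case ()
  go (cons u v) eq =
    let τ , r , q = ifEq-run (hd e) s {c = ifEq (tl e) t c d} {d}
          (λ hd≡ → ifEq-run (tl e) t {c = c} {d}
            (λ tl≡ → yes-run (trans eq (cong₂ cons (trans (cong head (sym eq)) hd≡)
                                                   (trans (cong tail (sym eq)) tl≡))))
            (λ tl≢ → no-run (λ e≡ → tl≢ (cong tail e≡))))
          (λ hd≢ → let τ , r , q = no-run (λ e≡ → hd≢ (cong head e≡)) in
            τ , weaken (≤-ifEqCost (tl e) t a) r , q)
    in τ , then-run eq r , q

-- The lists of candidates before and after the current set are in cur and next, that set is in row, the
-- current candidate in cand; fam holds the sets still to come.
io x y z cand row cur next fam bud : Fin 10
io   = # 0
x    = # 1
y    = # 2
z    = # 3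
cand = # 4
row  = # 5
cur  = # 6
next = # 7
fam  = # 8
bud  = # 9

unary : ℕ → Tree
unary zero    = nil
unary (suc k) = cons nil (unary k)

bits : ∀ {n} → Subset n → List Tree
bits p = List.map encodeBool (Vec.toList p)

length-bits : ∀ {n} (p : Subset n) → length (bits p) ≡ n
length-bits []      = refl
length-bits (_ ∷ p) = cong suc (length-bits p)

reverseX : Cmd 10
reverseX = while var x run
  (y := cons (hd (var x)) (var y) ⨾ x := tl (var x))

reverseX-run : ∀ {w} .{{_ : NonZero w}} ts {i us} {ρ : Vec Tree 7} → length ts ≤ w →
  w ⊢⟨ reverseX , i ∷ encodeList ts ∷ encodeList us ∷ ρ ⟩⇓[ 13 ] (i ∷ nil ∷ encodeList (ts ʳ++ us) ∷ ρ)
-- A round costs 11 and the failing last test costs 2; the constants of the later loops arise in the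
-- same way.
reverseX-run {w} ts l≤w = iterations {l = length ts} {11} {2} w l≤w (ℕ.≤-reflexive (ℕ.*-identityʳ w)) (loop ts _)
  where
  loop : ∀ ts us {i} {ρ : Vec Tree 7} → 1 ⊢⟨ reverseX , i ∷ encodeList ts ∷ encodeList us ∷ ρ ⟩⇓[ length ts * 11 + 2 ]
    (i ∷ nil ∷ encodeList (ts ʳ++ us) ∷ ρ)
  loop []       us = stop refl
  loop (t ∷ ts) us = iterate refl (set ▸ set) (loop ts (t ∷ us))

-- The input does not state `n`; the length of a row supplies it.
zerosX : Cmd 10
zerosX = while var x run
  (y := cons nil (var y) ⨾ x := tl (var x))

-- The bit of an absent element is `nil`, so the empty set and the unary number `n` share one code.
encodeSubset-⊥ : ∀ n → encodeSubset (Subset.⊥ {n}) ≡ unary n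
encodeSubset-⊥ zero    = refl
encodeSubset-⊥ (suc n) = cong (cons nil) (encodeSubset-⊥ n)

zerosX-run : ∀ {w n} .{{_ : NonZero w}} (A : Subset n) {i} {ρ : Vec Tree 7} → n ≤ w →
  w ⊢⟨ zerosX , i ∷ encodeSubset A ∷ nil ∷ ρ ⟩⇓[ 12 ] (i ∷ nil ∷ encodeSubset (Subset.⊥ {n}) ∷ ρ)
zerosX-run {w} {n} A n≤w = iterations {l = n} {10} {2} w n≤w (ℕ.≤-reflexive (ℕ.*-identityʳ w))
  (loop A 0 (trans (cong unary (ℕ.+-identityʳ n)) (sym (encodeSubset-⊥ n))))
  where
  loop : ∀ {n} (A : Subset n) k {t i} {ρ : Vec Tree 7} → unary (n + k) ≡ t →
    1 ⊢⟨ zerosX , i ∷ encodeSubset A ∷ unary k ∷ ρ ⟩⇓[ n * 10 + 2 ] (i ∷ nil ∷ t ∷ ρ)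
  loop []              k refl = stop refl
  loop {suc n} (_ ∷ A) k eq   = iterate refl (set ▸ set) (loop A (suc k) (trans (cong unary (ℕ.+-suc n k)) eq))

unionX : Cmd 10
unionX = while var x run
  ((if hd (var x) then (z := cons (cons nil nil) (var z)) else (z := cons (hd (var y)) (var z)))
   ⨾ x := tl (var x) ⨾ y := tl (var y))

unionX-run : ∀ {w n} .{{_ : NonZero w}} (A B : Subset n) {i} {ρ : Vec Tree 6} → n ≤ w →
  w ⊢⟨ unionX , i ∷ encodeSubset A ∷ encodeSubset B ∷ nil ∷ ρ ⟩⇓[ 21 ]
    (i ∷ nil ∷ nil ∷ encodeList (bits (A ∪ B) ʳ++ []) ∷ ρ)
unionX-run {w} {n} A B n≤w = iterations {l = n} {19} {2} w n≤w (ℕ.≤-reflexive (ℕ.*-identityʳ w)) (loop A B [])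
  where
  loop : ∀ {n} (A B : Subset n) us {i} {ρ : Vec Tree 6} →
    1 ⊢⟨ unionX , i ∷ encodeSubset A ∷ encodeSubset B ∷ encodeList us ∷ ρ ⟩⇓[ n * 19 + 2 ]
      (i ∷ nil ∷ nil ∷ encodeList (bits (A ∪ B) ʳ++ us) ∷ ρ)
  loop []           []      us = stop refl
  loop (true  ∷ A) (_ ∷ B) us = iterate refl (then-run refl set ▸ set ▸ set) (loop A B (cons nil nil ∷ us))
  loop (false ∷ A) (b ∷ B) us =
    -- This branch costs 8 and is padded to the 9 of the other, so that all rounds have the same
    -- bound.
    iterate refl (relax {b = 9} (else-run refl set) ▸ set ▸ set) (loop A B (encodeBool b ∷ us))

union : Cmd 10
union = x := var row ⨾ y := tl (tl (var cand)) ⨾ unionX ⨾ x := var z ⨾ z := nil ⨾ reverseX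

union-run : ∀ {w n} .{{_ : NonZero w}} (A B : Subset n) {i s t} {ρ : Vec Tree 4} → n ≤ w →
  w ⊢⟨ union , i ∷ nil ∷ nil ∷ nil ∷ cons s (cons t (encodeSubset B)) ∷ encodeSubset A ∷ ρ ⟩⇓[ 60 ]
    (i ∷ nil ∷ encodeSubset (A ∪ B) ∷ nil ∷ cons s (cons t (encodeSubset B)) ∷ encodeSubset A ∷ ρ)
union-run {w} {n} A B {i} {s} {t} {ρ} n≤w = subst
  (λ u → w ⊢⟨ union , i ∷ nil ∷ nil ∷ nil ∷ cons s (cons t (encodeSubset B)) ∷ encodeSubset A ∷ ρ ⟩⇓[ 60 ]
    (i ∷ nil ∷ encodeList u ∷ nil ∷ cons s (cons t (encodeSubset B)) ∷ encodeSubset A ∷ ρ))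
  (List.reverse-involutive (bits (A ∪ B)))
  (relax (set ▸ set ▸ unionX-run A B n≤w ▸ set ▸ set ▸ reverseX-run (bits (A ∪ B) ʳ++ []) {us = []} short))
  where
  short : length (bits (A ∪ B) ʳ++ []) ≤ w
  short = subst (_≤ w) (sym (trans (List.length-reverse (bits (A ∪ B))) (length-bits (A ∪ B)))) n≤w

-- Enumerating the candidates

-- A set T of indices, paired with the number of indices that may still be added to it.
Candidate : ℕ → Set
Candidate i = ℕ × Subset i

extend : ∀ {i} → Candidate i → List (Candidate (suc i)) → List (Candidate (suc i))
extend (zero  , T) cs = (zero , outside ∷ T) ∷ cs
extend (suc r , T) cs = (r , inside ∷ T) ∷ (suc r , outside ∷ T) ∷ cs

-- The accumulator mirrors the program, which pushes new candidates onto `next`.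
extendAll : ∀ {i} → List (Candidate i) → List (Candidate (suc i)) → List (Candidate (suc i))
extendAll []       ks = ks
extendAll (c ∷ cs) ks = extendAll cs (extend c ks)

candidates : ∀ i → ℕ → List (Candidate i)
candidates zero    b = (b , []) ∷ []
candidates (suc i) b = extendAll (candidates i b) []

∈-extend⁺ : ∀ {i} c {k} {ks : List (Candidate (suc i))} → k ∈ₗ ks → k ∈ₗ extend c ks
∈-extend⁺ (zero  , T) k∈ = there k∈
∈-extend⁺ (suc r , T) k∈ = there (there k∈)

∈-extendAll⁺ : ∀ {i} (cs : List (Candidate i)) {k ks} → k ∈ₗ ks → k ∈ₗ extendAll cs ks
∈-extendAll⁺ []       k∈ = k∈
∈-extendAll⁺ (c ∷ cs) k∈ = ∈-extendAll⁺ cs (∈-extend⁺ c k∈)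

outside-∈-extendAll : ∀ {i} {cs : List (Candidate i)} {r T ks} →
  (r , T) ∈ₗ cs → (r , outside ∷ T) ∈ₗ extendAll cs ks
outside-∈-extendAll {cs = (zero  , _) ∷ cs} (here refl) = ∈-extendAll⁺ cs (here refl)
outside-∈-extendAll {cs = (suc _ , _) ∷ cs} (here refl) = ∈-extendAll⁺ cs (there (here refl))
outside-∈-extendAll {cs = _ ∷ _}            (there c∈)  = outside-∈-extendAll c∈

inside-∈-extendAll : ∀ {i} {cs : List (Candidate i)} {r T ks} →
  (suc r , T) ∈ₗ cs → (r , inside ∷ T) ∈ₗ extendAll cs ks
inside-∈-extendAll {cs = _ ∷ cs} (here refl) = ∈-extendAll⁺ cs (here refl)
inside-∈-extendAll {cs = _ ∷ _}  (there c∈)  = inside-∈-extendAll c∈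

-- Completeness of the enumeration. Undoing the choice of a set returns one unit of budget, which is
-- why `r` is left general.
∈-candidates⁺ : ∀ {i} (T : Subset i) r → (r , T) ∈ₗ candidates i (∣ T ∣ + r)
∈-candidates⁺ []            r = here refl
∈-candidates⁺ (outside ∷ T) r = outside-∈-extendAll (∈-candidates⁺ T r)
∈-candidates⁺ {suc i} (inside ∷ T) r =
  inside-∈-extendAll (subst (λ b → (suc r , T) ∈ₗ candidates i b) (ℕ.+-suc ∣ T ∣ r) (∈-candidates⁺ T (suc r)))

WithinBudget : ∀ {i} → ℕ → Candidate i → Set
WithinBudget b (r , T) = ∣ T ∣ + r ≡ b

extend-budget : ∀ {i b} (c : Candidate i) {ks} →
  WithinBudget b c → All (WithinBudget b) ks → All (WithinBudget b) (extend c ks)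
extend-budget (zero  , T) eq all = eq ∷ all
extend-budget (suc r , T) eq all = trans (sym (ℕ.+-suc ∣ T ∣ r)) eq ∷ eq ∷ all

extendAll-budget : ∀ {i b} {cs : List (Candidate i)} {ks} →
  All (WithinBudget b) cs → All (WithinBudget b) ks → All (WithinBudget b) (extendAll cs ks)
extendAll-budget []                   ks-all = ks-all
extendAll-budget {cs = c ∷ _} (eq ∷ eqs) ks-all = extendAll-budget eqs (extend-budget c eq ks-all)

candidates-budget : ∀ i b → All (WithinBudget b) (candidates i b)
candidates-budget zero    b = refl ∷ []
candidates-budget (suc i) b = extendAll-budget (candidates-budget i b) []

-- With j further sets to come, a candidate with budget r has at most (1 + j)^r descendants.
potential : ∀ {i} → ℕ → List (Candidate i) → ℕ
potential j []             = 0
potential j ((r , _) ∷ cs) = suc j ^ r + potential j cs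

-- Branching does not raise the potential: `(1 + j)^r + (1 + j)^(1 + r) = (2 + j)(1 +
-- j)^r`, which is at most `(2 + j)^(1 + r)`.
extend-potential : ∀ {i} j (c : Candidate i) ks →
  potential j (extend c ks) ≤ suc (suc j) ^ proj₁ c + potential j ks
extend-potential j (zero  , T) ks = ℕ.≤-refl
extend-potential j (suc r , T) ks = begin
  suc j ^ r + (suc j * suc j ^ r + p)
    ≡⟨ ℕ.+-assoc (suc j ^ r) _ p ⟨
  suc (suc j) * suc j ^ r + p
    ≤⟨ ℕ.+-monoˡ-≤ p (ℕ.*-monoʳ-≤ (suc (suc j)) (ℕ.^-monoˡ-≤ r (ℕ.n≤1+n (suc j)))) ⟩
  suc (suc j) * suc (suc j) ^ r + p ∎
  where
  open ℕ.≤-Reasoning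
  p : ℕ
  p = potential j ks

extendAll-potential : ∀ {i} j (cs : List (Candidate i)) ks →
  potential j (extendAll cs ks) ≤ potential (suc j) cs + potential j ks
extendAll-potential j []             ks = ℕ.≤-refl
extendAll-potential j (c@(r , _) ∷ cs) ks = begin
  potential j (extendAll cs (extend c ks))      ≤⟨ extendAll-potential j cs (extend c ks) ⟩
  p + potential j (extend c ks)                 ≤⟨ ℕ.+-monoʳ-≤ p (extend-potential j c ks) ⟩
  p + (suc (suc j) ^ r + potential j ks)        ≡⟨ swap p (suc (suc j) ^ r) (potential j ks) ⟩
  suc (suc j) ^ r + p + potential j ks          ∎
  where
  open ℕ.≤-Reasoning
  p : ℕ
  p = potential (suc j) cs
  swap : ∀ a b c → a + (b + c) ≡ b + a + c
  swap = solve-∀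

candidates-potential : ∀ i j b → potential j (candidates i b) ≤ suc (i + j) ^ b
candidates-potential zero    j b = ℕ.≤-reflexive (ℕ.+-identityʳ (suc j ^ b))
candidates-potential (suc i) j b = begin
  potential j (candidates (suc i) b)          ≤⟨ extendAll-potential j (candidates i b) [] ⟩
  potential (suc j) (candidates i b) + 0      ≡⟨ ℕ.+-identityʳ _ ⟩
  potential (suc j) (candidates i b)          ≤⟨ candidates-potential i (suc j) b ⟩
  suc (i + suc j) ^ b                         ≡⟨ cong (λ k → suc k ^ b) (ℕ.+-suc i j) ⟩
  suc (suc i + j) ^ b                         ∎
  where open ℕ.≤-Reasoning

length≤potential : ∀ {i} j (cs : List (Candidate i)) → length cs ≤ potential j cs
length≤potential j []             = z≤n
length≤potential j ((r , _) ∷ cs) = ℕ.+-mono-≤ (ℕ.m^n>0 (suc j) r) (length≤potential j cs)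

length-candidates : ∀ i b → length (candidates i b) ≤ suc i ^ b
length-candidates i b = ℕ.≤-trans (length≤potential 0 (candidates i b))
  (subst (λ k → potential 0 (candidates i b) ≤ suc k ^ b) (ℕ.+-identityʳ i) (candidates-potential i 0 b))

-- Storing the union lets each set be discarded after its round, and leaves only bits to count when
-- candidates are compared.
encodeCandidate : ∀ {n i} → Vec (Subset n) i → Candidate i → Tree
encodeCandidate As (r , T) = cons (unary r) (cons (encodeSubset T) (encodeSubset (⋃[ T ] As)))

encodeCandidates : ∀ {n i} → Vec (Subset n) i → List (Candidate i) → Tree
encodeCandidates As cs = encodeList (List.map (encodeCandidate As) cs)

extendCmd : Cmd 10
extendCmd =
  cand := hd (var cur) ⨾
  cur := tl (var cur) ⨾
  next := cons (cons (hd (var cand)) (cons (cons nil (hd (tl (var cand)))) (tl (tl (var cand))))) (var next) ⨾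
  (if hd (var cand)
   then (union ⨾
         next := cons (cons (tl (hd (var cand))) (cons (cons (cons nil nil) (hd (tl (var cand)))) (var y)))
                      (var next) ⨾
         y := nil)
   else (y := nil)) ⨾
  cand := nil

extendCmd-run : ∀ {w n i} .{{_ : NonZero w}} (A : Subset n) (As : Vec (Subset n) i) c ks {o l} {ρ : Vec Tree 2} →
  n ≤ w →
  w ⊢⟨ extendCmd ,
       o ∷ nil ∷ nil ∷ nil ∷ nil ∷ encodeSubset A ∷ cons (encodeCandidate As c) l
         ∷ encodeCandidates (A ∷ As) ks ∷ ρ ⟩⇓[ 150 ]
      (o ∷ nil ∷ nil ∷ nil ∷ nil ∷ encodeSubset A ∷ l ∷ encodeCandidates (A ∷ As) (extend c ks) ∷ ρ)
extendCmd-run A As (zero  , T) ks n≤w = relax (set ▸ set ▸ set ▸ else-run refl set ▸ set)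
extendCmd-run A As (suc r , T) ks n≤w = relax
  (set ▸ set ▸ set ▸ then-run refl (union-run A (⋃[ T ] As) n≤w ▸ set ▸ set) ▸ set)

extendAllCmd : Cmd 10
extendAllCmd = while var cur run extendCmd

extendAllCmd-run : ∀ {w n i N} .{{_ : NonZero w}} .{{_ : NonZero N}}
  (A : Subset n) (As : Vec (Subset n) i) cs {o} {ρ : Vec Tree 2} →
  n ≤ w → length cs ≤ N →
  N * w ⊢⟨ extendAllCmd , o ∷ nil ∷ nil ∷ nil ∷ nil ∷ encodeSubset A ∷ encodeCandidates As cs ∷ nil ∷ ρ ⟩⇓[ 154 ]
    (o ∷ nil ∷ nil ∷ nil ∷ nil ∷ encodeSubset A ∷ nil ∷ encodeCandidates (A ∷ As) (extendAll cs []) ∷ ρ)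
extendAllCmd-run {w} {N = N} A As cs {o} {ρ} n≤w l≤N =
  iterations {l = length cs} {152} {2} N l≤N ℕ.≤-refl (loop cs [])
  where
  loop : ∀ cs ks →
    w ⊢⟨ extendAllCmd , o ∷ nil ∷ nil ∷ nil ∷ nil ∷ encodeSubset A ∷ encodeCandidates As cs
           ∷ encodeCandidates (A ∷ As) ks ∷ ρ ⟩⇓[ length cs * 152 + 2 ]
      (o ∷ nil ∷ nil ∷ nil ∷ nil ∷ encodeSubset A ∷ nil ∷ encodeCandidates (A ∷ As) (extendAll cs ks) ∷ ρ)
  loop []       ks = stop refl
  loop (c ∷ cs) ks = iterate refl (extendCmd-run A As c ks n≤w) (loop cs (extend c ks))

-- The sets are processed last to first, so that a subfamily grows at its front.
data RevOnto {n} : ∀ {i m} → List (Subset n) → Vec (Subset n) i → Vec (Subset n) m → Set where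
  done : ∀ {m} {As : Vec (Subset n) m} → RevOnto [] As As
  push : ∀ {i m A Ps} {As : Vec (Subset n) i} {Bs : Vec (Subset n) m} →
    RevOnto Ps (A ∷ As) Bs → RevOnto (A ∷ Ps) As Bs

revOnto-ʳ++ : ∀ {n i m} (As : Vec (Subset n) i) {Ps} {Bs : Vec (Subset n) m} →
  RevOnto Ps As Bs → RevOnto (Vec.toList As ʳ++ Ps) [] Bs
revOnto-ʳ++ []       r = r
revOnto-ʳ++ (A ∷ As) r = revOnto-ʳ++ As (push r)

revOnto-length : ∀ {n i m Ps} {As : Vec (Subset n) i} {Bs : Vec (Subset n) m} → RevOnto Ps As Bs → length Ps + i ≡ m
revOnto-length done     = refl
revOnto-length (push {i} {Ps = Ps} r) = trans (sym (ℕ.+-suc (length Ps) i)) (revOnto-length r)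

enumerate : Cmd 10
enumerate = while var fam run
  (row := hd (var fam) ⨾ fam := tl (var fam) ⨾ extendAllCmd ⨾ cur := var next ⨾ next := nil ⨾ row := nil)

enumerate-run : ∀ {w n m b N M} .{{_ : NonZero w}} .{{_ : NonZero N}} .{{_ : NonZero M}}
  (As : Vec (Subset n) m) {o bd} → n ≤ w → suc m ^ b ≤ N → m ≤ M →
  M * (N * w) ⊢⟨ enumerate ,
      o ∷ nil ∷ nil ∷ nil ∷ nil ∷ nil ∷ encodeCandidates {n} [] (candidates 0 b) ∷ nil
        ∷ encodeList (List.map encodeSubset (Vec.toList As ʳ++ [])) ∷ bd ∷ [] ⟩⇓[ 180 ]
    (o ∷ nil ∷ nil ∷ nil ∷ nil ∷ nil ∷ encodeCandidates As (candidates m b) ∷ nil ∷ nil ∷ bd ∷ [])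
enumerate-run {w} {n} {m} {b} {N} {M} As {o} {bd} n≤w sm^b≤N m≤M =
  relax (iterations {l = length (Vec.toList As ʳ++ [])} {175} {2} M
    (subst (_≤ M) (trans (sym (revOnto-length reversed)) (ℕ.+-identityʳ _)) m≤M) ℕ.≤-refl (loop reversed))
  where
  reversed : RevOnto (Vec.toList As ʳ++ []) [] As
  reversed = revOnto-ʳ++ As done

  instance
    Nw≢0 : NonZero (N * w)
    Nw≢0 = ℕ.m*n≢0 N w

  loop : ∀ {Ps i} {Bs : Vec (Subset n) i} → RevOnto Ps Bs As →
    N * w ⊢⟨ enumerate ,
        o ∷ nil ∷ nil ∷ nil ∷ nil ∷ nil ∷ encodeCandidates Bs (candidates i b) ∷ nil
          ∷ encodeList (List.map encodeSubset Ps) ∷ bd ∷ [] ⟩⇓[ length Ps * 175 + 2 ]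
      (o ∷ nil ∷ nil ∷ nil ∷ nil ∷ nil ∷ encodeCandidates As (candidates m b) ∷ nil ∷ nil ∷ bd ∷ [])
  loop done = stop refl
  loop {A ∷ Ps} {i} {Bs} r@(push r′) = iterate refl
    (relax {b = 173} (set ▸ set ▸ extendAllCmd-run A Bs (candidates i b) n≤w short ▸ set ▸ set ▸ set))
    (loop r′)
    where
    short : length (candidates i b) ≤ N
    short = ℕ.≤-trans (length-candidates i b) (ℕ.≤-trans
      (ℕ.^-monoˡ-≤ b (s≤s (subst (i ≤_) (revOnto-length r) (ℕ.m≤n+m i _)))) sm^b≤N)

-- Choosing the best candidate

-- The number is the old count `∸` the new one, so `zero` means that the new candidate covers at
-- least as much; ties go to it.
better : ∀ {i} → ℕ → Subset i × ℕ → Subset i × ℕ → Subset i × ℕ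
better zero    old new = new
better (suc _) old new = old

choose : ∀ {n i} → Vec (Subset n) i → Subset i × ℕ → Subset i → Subset i × ℕ
choose As (T , d) T′ = better (d ∸ ∣ ⋃[ T′ ] As ∣) (T , d) (T′ , ∣ ⋃[ T′ ] As ∣)

chooseAll : ∀ {n i} → Vec (Subset n) i → Subset i × ℕ → List (Candidate i) → Subset i × ℕ
chooseAll As s []             = s
chooseAll As s ((_ , T) ∷ cs) = chooseAll As (choose As s T) cs

chooseAll-invariant : ∀ {n i} (As : Vec (Subset n) i) (P : Subset i × ℕ → Set) {s} {cs : List (Candidate i)} →
  P s → All (λ (_ , T) → P (T , ∣ ⋃[ T ] As ∣)) cs → P (chooseAll As s cs)
chooseAll-invariant As P p []       = p
chooseAll-invariant As P {T , d} {(_ , T′) ∷ _} p (p′ ∷ ps) =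
  chooseAll-invariant As P (go (d ∸ ∣ ⋃[ T′ ] As ∣)) ps
  where
  go : ∀ r → P (better r (T , d) (T′ , ∣ ⋃[ T′ ] As ∣))
  go zero    = p′
  go (suc _) = p

choose-≥ : ∀ {n i} (As : Vec (Subset n) i) T d T′ →
  d ≤ proj₂ (choose As (T , d) T′) × ∣ ⋃[ T′ ] As ∣ ≤ proj₂ (choose As (T , d) T′)
choose-≥ As T d T′ with d ∸ ∣ ⋃[ T′ ] As ∣ in eq
... | zero  = ℕ.m∸n≡0⇒m≤n eq , ℕ.≤-refl
... | suc _ = ℕ.≤-refl , ℕ.<⇒≤ (ℕ.m∸n≢0⇒n<m (λ ≡0 → ℕ.0≢1+n (trans (sym ≡0) eq)))

chooseAll-≥ : ∀ {n i} (As : Vec (Subset n) i) s cs → proj₂ s ≤ proj₂ (chooseAll As s cs)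
chooseAll-≥ As s       []              = ℕ.≤-refl
chooseAll-≥ As (T , d) ((_ , T′) ∷ cs) =
  ℕ.≤-trans (proj₁ (choose-≥ As T d T′)) (chooseAll-≥ As (choose As (T , d) T′) cs)

chooseAll-∈ : ∀ {n i} (As : Vec (Subset n) i) s {cs r T} → (r , T) ∈ₗ cs →
  ∣ ⋃[ T ] As ∣ ≤ proj₂ (chooseAll As s cs)
chooseAll-∈ As (T , d) {(_ , T′) ∷ cs} (here refl) =
  ℕ.≤-trans (proj₂ (choose-≥ As T d T′)) (chooseAll-≥ As (choose As (T , d) T′) cs)
chooseAll-∈ As (T , d) {(_ , T′) ∷ cs} (there c∈) = chooseAll-∈ As (choose As (T , d) T′) c∈

-- Counting and comparing in one pass: `y` loses a unit per element found, and `tail nil = nil`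
-- makes this truncated subtraction. The assignment `z := var z` serves as a skip.
countX : Cmd 10
countX = while var x run
  ((if hd (var x) then (z := cons nil (var z) ⨾ y := tl (var y)) else (z := var z)) ⨾ x := tl (var x))

countX-run : ∀ {w n} .{{_ : NonZero w}} (A : Subset n) d {i} {ρ : Vec Tree 6} → n ≤ w →
  w ⊢⟨ countX , i ∷ encodeSubset A ∷ unary d ∷ nil ∷ ρ ⟩⇓[ 19 ]
    (i ∷ nil ∷ unary (d ∸ ∣ A ∣) ∷ unary ∣ A ∣ ∷ ρ)
countX-run {w} {n} A d n≤w = iterations {l = n} {17} {2} w n≤w (ℕ.≤-reflexive (ℕ.*-identityʳ w))
  (loop A d 0 refl (ℕ.+-identityʳ ∣ A ∣))
  where
  loop : ∀ {n} (A : Subset n) d k {e l i} {ρ : Vec Tree 6} → d ∸ ∣ A ∣ ≡ e → ∣ A ∣ + k ≡ l →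
    1 ⊢⟨ countX , i ∷ encodeSubset A ∷ unary d ∷ unary k ∷ ρ ⟩⇓[ n * 17 + 2 ]
      (i ∷ nil ∷ unary e ∷ unary l ∷ ρ)
  loop []          d       k refl refl = stop refl
  loop (true  ∷ A) zero    k ∸-eq +-eq = iterate refl (then-run refl (set ▸ set) ▸ set)
    (loop A zero (suc k) (trans (ℕ.0∸n≡0 ∣ A ∣) ∸-eq) (trans (ℕ.+-suc ∣ A ∣ k) +-eq))
  loop (true  ∷ A) (suc d) k ∸-eq +-eq = iterate refl (then-run refl (set ▸ set) ▸ set)
    (loop A d (suc k) ∸-eq (trans (ℕ.+-suc ∣ A ∣ k) +-eq))
  loop (false ∷ A) d       k ∸-eq +-eq = iterate refl (relax {b = 11} (else-run refl set) ▸ set)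
    (loop A d k ∸-eq +-eq)

replaceIfBetter : Cmd 10
replaceIfBetter = if var y then (z := nil) else (io := hd (tl (var cand)) ⨾ row := var z ⨾ z := nil)

replaceIfBetter-run : ∀ {w i} .{{_ : NonZero w}} r {T T′ : Subset i} {d d′ s t} {ρ : Vec Tree 4} →
  w ⊢⟨ replaceIfBetter ,
      encodeSubset T ∷ nil ∷ unary r ∷ unary d′ ∷ cons s (cons (encodeSubset T′) t) ∷ unary d ∷ ρ ⟩⇓[ 20 ]
    (encodeSubset (proj₁ (better r (T , d) (T′ , d′))) ∷ nil ∷ unary r ∷ nil ∷ cons s (cons (encodeSubset T′) t)
       ∷ unary (proj₂ (better r (T , d) (T′ , d′))) ∷ ρ)
replaceIfBetter-run zero    = relax (else-run refl (set ▸ set ▸ set))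
replaceIfBetter-run (suc r) = relax (then-run refl set)

chooseCmd : Cmd 10
chooseCmd =
  cand := hd (var cur) ⨾ cur := tl (var cur) ⨾ x := tl (tl (var cand)) ⨾ y := var row ⨾
  countX ⨾ replaceIfBetter ⨾ y := nil ⨾ cand := nil

chooseAllCmd : Cmd 10
chooseAllCmd = while var cur run chooseCmd

chooseAllCmd-run : ∀ {w n i N} .{{_ : NonZero w}} .{{_ : NonZero N}} (As : Vec (Subset n) i) T d cs {ρ : Vec Tree 3} →
  n ≤ w → length cs ≤ N →
  N * w ⊢⟨ chooseAllCmd ,
      encodeSubset T ∷ nil ∷ nil ∷ nil ∷ nil ∷ unary d ∷ encodeCandidates As cs ∷ ρ ⟩⇓[ 120 ]
    (encodeSubset (proj₁ (chooseAll As (T , d) cs)) ∷ nil ∷ nil ∷ nil ∷ nil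
       ∷ unary (proj₂ (chooseAll As (T , d) cs)) ∷ nil ∷ ρ)
chooseAllCmd-run {w} {N = N} As T d cs {ρ} n≤w l≤N =
  relax (iterations {l = length cs} {110} {2} N l≤N ℕ.≤-refl (loop T d cs))
  where
  loop : ∀ T d cs →
    w ⊢⟨ chooseAllCmd ,
        encodeSubset T ∷ nil ∷ nil ∷ nil ∷ nil ∷ unary d ∷ encodeCandidates As cs ∷ ρ ⟩⇓[ length cs * 110 + 2 ]
      (encodeSubset (proj₁ (chooseAll As (T , d) cs)) ∷ nil ∷ nil ∷ nil ∷ nil
         ∷ unary (proj₂ (chooseAll As (T , d) cs)) ∷ nil ∷ ρ)
  loop T d []              = stop refl
  loop T d ((_ , T′) ∷ cs) = iterate refl
    (relax {b = 108} (set ▸ set ▸ set ▸ set ▸ countX-run (⋃[ T′ ] As) d n≤w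
      ▸ replaceIfBetter-run (d ∸ ∣ ⋃[ T′ ] As ∣) {T} {T′} {d} ▸ set ▸ set))
    (loop _ _ cs)

-- The budget

encodeℕᵇ-injective : ∀ {a b} → encodeℕᵇ a ≡ encodeℕᵇ b → a ≡ b
encodeℕᵇ-injective {ℕᵇ.zero} {ℕᵇ.zero} eq = refl
encodeℕᵇ-injective {2[1+ a ]} {2[1+ b ]} eq = cong 2[1+_] (encodeℕᵇ-injective (cong tail eq))
encodeℕᵇ-injective {1+[2 a ]} {1+[2 b ]} eq = cong 1+[2_] (encodeℕᵇ-injective (cong tail eq))
encodeℕᵇ-injective {2[1+ a ]} {1+[2 b ]} ()
encodeℕᵇ-injective {1+[2 a ]} {2[1+ b ]} ()

unaryExpr : ∀ {k} → ℕ → Expr k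
unaryExpr zero    = nil
unaryExpr (suc j) = cons nil (unaryExpr j)

eval-unaryExpr : ∀ {k} j {σ : Store k} → eval (unaryExpr j) σ ≡ unary j
eval-unaryExpr zero    = refl
eval-unaryExpr (suc j) = cong (cons nil) (eval-unaryExpr j)

-- Comparing `K` with `K₀ - 1`, ..., 0 either identifies it or shows `K₀ ≤ K`. This takes constant
-- time and never expands the binary number.
truncate : ℕ → ℕ → Cmd 10
truncate K₀ zero    = bud := unaryExpr K₀
truncate K₀ (suc j) = ifEq (hd (var io)) (encodeℕᵇ (fromℕ j)) (bud := unaryExpr j) (truncate K₀ j)

truncateCost : ℕ → ℕ → ℕ
truncateCost K₀ zero    = suc (cost {10} (unaryExpr K₀))
truncateCost K₀ (suc j) =
  ifEqCost {10} (hd (var io)) (encodeℕᵇ (fromℕ j)) (suc (cost {10} (unaryExpr j)) + truncateCost K₀ j)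

-- `b` is the minimum of `k` and `K₀`, in the form of the case split made in `best-ratio`.
IsBudget : ℕ → ℕ → ℕ → Set
IsBudget k K₀ b = b ≤ k × b ≤ K₀ × (b ≡ k ⊎ b ≡ K₀)

setBudget : ∀ {w} .{{_ : NonZero w}} j {σ : Vec Tree 9} {t} →
  w ⊢⟨ bud := unaryExpr j , σ Vec.++ t ∷ [] ⟩⇓[ suc (cost {10} (unaryExpr j)) ] (σ Vec.++ unary j ∷ [])
setBudget {w} j {σ@(_ ∷ _ ∷ _ ∷ _ ∷ _ ∷ _ ∷ _ ∷ _ ∷ _ ∷ [])} {t} =
  subst (λ u → w ⊢⟨ bud := unaryExpr j , σ Vec.++ t ∷ [] ⟩⇓[ suc (cost {10} (unaryExpr j)) ] (σ Vec.++ u ∷ []))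
    (eval-unaryExpr j) set

-- The disjunction is the invariant: the failed tests have excluded every value from `j` up to
-- `K₀ - 1`. At `j = 0` only `K₀ ≤ k` remains.
truncate-run : ∀ {w} .{{_ : NonZero w}} k K₀ j {i} {σ : Vec Tree 8} {t} → K₀ ≤ k ⊎ k < j → j ≤ K₀ →
  ∃[ τ ] w ⊢⟨ truncate K₀ j , cons (encodeℕᵇ (fromℕ k)) i ∷ σ Vec.++ t ∷ [] ⟩⇓[ truncateCost K₀ j ] τ
    × ∃[ b ] (IsBudget k K₀ b × τ ≡ cons (encodeℕᵇ (fromℕ k)) i ∷ σ Vec.++ unary b ∷ [])
truncate-run k K₀ zero {i} {σ} (inj₁ K₀≤k) _ =
  _ , setBudget K₀ {cons (encodeℕᵇ (fromℕ k)) i ∷ σ} , K₀ , (K₀≤k , ℕ.≤-refl , inj₂ refl) , refl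
truncate-run k K₀ (suc j) {i} {σ} cmp j<K₀ = ifEq-run (hd (var io)) (encodeℕᵇ (fromℕ j))
  (λ eq → let j≡k = sym (ℕᵇ.fromℕ-injective (encodeℕᵇ-injective eq)) in
    _ , weaken (ℕ.m≤m+n _ (truncateCost K₀ j)) (setBudget j {cons (encodeℕᵇ (fromℕ k)) i ∷ σ})
      , j , (ℕ.≤-reflexive j≡k , ℕ.<⇒≤ j<K₀ , inj₁ j≡k) , refl)
  (λ neq → let τ , r , q = truncate-run k K₀ j (further neq cmp) (ℕ.<⇒≤ j<K₀) in
    τ , weaken (ℕ.m≤n+m (truncateCost K₀ j) _) r , q)
  where
  further : encodeℕᵇ (fromℕ k) ≢ encodeℕᵇ (fromℕ j) → K₀ ≤ k ⊎ k < suc j → K₀ ≤ k ⊎ k < j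
  further neq (inj₁ K₀≤k)      = inj₁ K₀≤k
  further neq (inj₂ (s≤s k≤j)) = inj₂ (ℕ.≤∧≢⇒< k≤j (λ k≡j → neq (cong (λ a → encodeℕᵇ (fromℕ a)) k≡j)))

firstRow : Cmd 10
firstRow = x := hd (var fam) ⨾ zerosX

prepare : Cmd 10
prepare =
  x := tl (var io) ⨾ reverseX ⨾ fam := var y ⨾ y := nil ⨾
  -- The only initial candidate has the full budget, no indices (`nil`) and the empty union, which
  -- `firstRow` left in `y`.
  firstRow ⨾ cur := cons (cons (var bud) (cons nil (var y))) nil ⨾ y := nil

-- The search starts from the first candidate with recorded count 0, an underestimate of its
-- coverage.
finish : Cmd 10
finish = row := nil ⨾ io := hd (tl (hd (var cur))) ⨾ chooseAllCmd

body : ℕ → Cmd 10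
body K₀ = truncate K₀ K₀ ⨾ prepare ⨾ enumerate ⨾ finish

program : ℕ → Program
program K₀ = record { extraVars = 9 ; body = body K₀ }

firstRow-run : ∀ {w n m} .{{_ : NonZero w}} .{{_ : NonZero m}} (As : Vec (Subset n) m) {o f b} → n ≤ w →
  f ≡ encodeList (List.map encodeSubset (Vec.toList As ʳ++ [])) →
  w ⊢⟨ firstRow , o ∷ nil ∷ nil ∷ nil ∷ nil ∷ nil ∷ nil ∷ nil ∷ f ∷ b ∷ [] ⟩⇓[ 20 ]
    (o ∷ nil ∷ encodeSubset (Subset.⊥ {n}) ∷ nil ∷ nil ∷ nil ∷ nil ∷ nil ∷ f ∷ b ∷ [])
-- The length equation rules out an empty list, as there is at least one set.
firstRow-run {m = suc _} As n≤w refl with Vec.toList As ʳ++ [] | revOnto-length (revOnto-ʳ++ As done)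
firstRow-run {m = suc _} As n≤w refl | A ∷ _ | _ = relax (set ▸ zerosX-run A n≤w)

prepare-run : ∀ {w n m} .{{_ : NonZero w}} .{{_ : NonZero m}} (As : Vec (Subset n) m) {kt b} → n ≤ w → m ≤ w →
  let o = cons kt (encodeList (List.map encodeSubset (Vec.toList As))) in
  w ⊢⟨ prepare , o ∷ nil ∷ nil ∷ nil ∷ nil ∷ nil ∷ nil ∷ nil ∷ nil ∷ unary b ∷ [] ⟩⇓[ 80 ]
    (o ∷ nil ∷ nil ∷ nil ∷ nil ∷ nil ∷ encodeCandidates {n} [] (candidates 0 b) ∷ nil
       ∷ encodeList (List.map encodeSubset (Vec.toList As ʳ++ [])) ∷ unary b ∷ [])
prepare-run {w} As n≤w m≤w rewrite List.map-ʳ++ encodeSubset (Vec.toList As) {[]} = relax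
  (set ▸ reverseX-run (List.map encodeSubset (Vec.toList As)) {us = []} short ▸ set ▸ set ▸
   firstRow-run As n≤w (cong encodeList (sym (List.map-ʳ++ encodeSubset (Vec.toList As)))) ▸ set ▸ set)
  where
  short : length (List.map encodeSubset (Vec.toList As)) ≤ w
  short = subst (_≤ w) (sym (trans (List.length-map encodeSubset (Vec.toList As)) (Vec.length-toList As))) m≤w

-- Correctness and running time

candidates-nonempty : ∀ i b → ∃[ c ] ∃[ cs ] candidates i b ≡ c ∷ cs
candidates-nonempty i b with candidates i b
  | subst (λ k → (b , Subset.⊥) ∈ₗ candidates i (k + b)) (∣⊥∣≡0 i) (∈-candidates⁺ {i} Subset.⊥ b)
... | c ∷ cs | _ = c , cs , refl

IsBest : ∀ {n m} → Vec (Subset n) m → ℕ → Subset m → Set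
IsBest As b T = ∣ T ∣ ≤ b × (∀ T′ → ∣ T′ ∣ ≤ b → ∣ ⋃[ T′ ] As ∣ ≤ ∣ ⋃[ T ] As ∣)

chooseAll-best : ∀ {n m} (As : Vec (Subset n) m) b T → ∣ T ∣ ≤ b →
  IsBest As b (proj₁ (chooseAll As (T , 0) (candidates m b)))
-- The invariant has `d ≤` and not equality, to admit the initial count 0.
chooseAll-best {m = m} As b T ∣T∣≤b with chooseAll-invariant As (λ (T , d) → ∣ T ∣ ≤ b × d ≤ ∣ ⋃[ T ] As ∣)
  {T , 0} {candidates m b} (∣T∣≤b , z≤n)
  (All.map (λ {(r , T)} eq → ℕ.m+n≤o⇒m≤o ∣ T ∣ (ℕ.≤-reflexive eq) , ℕ.≤-refl) (candidates-budget m b))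
... | ∣best∣≤b , d≤ = ∣best∣≤b , λ T′ ∣T′∣≤b → ℕ.≤-trans
  (chooseAll-∈ As (T , 0) (subst (λ k → (b ∸ ∣ T′ ∣ , T′) ∈ₗ candidates m k)
    (ℕ.m+[n∸m]≡n ∣T′∣≤b) (∈-candidates⁺ T′ (b ∸ ∣ T′ ∣)))) d≤

finish-run : ∀ {w n m N b} .{{_ : NonZero w}} .{{_ : NonZero N}} (As : Vec (Subset n) m) {o} {ρ : Vec Tree 3} →
  n ≤ w → suc m ^ b ≤ N →
  ∃[ T ] ∃[ d ] IsBest As b T ×
    N * w ⊢⟨ finish , o ∷ nil ∷ nil ∷ nil ∷ nil ∷ nil ∷ encodeCandidates As (candidates m b) ∷ ρ ⟩⇓[ 140 ]
      (encodeSubset T ∷ nil ∷ nil ∷ nil ∷ nil ∷ unary d ∷ nil ∷ ρ)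
finish-run {w} {m = m} {N} {b} As {o} {ρ} n≤w sm^b≤N
  with (r , T) , cs , eq ← candidates-nonempty m b = proj₁ chosen , proj₂ chosen , best , fast
  where
  chosen : Subset m × ℕ
  chosen = chooseAll As (T , 0) (candidates m b)

  instance
    Nw≢0 : NonZero (N * w)
    Nw≢0 = ℕ.m*n≢0 N w

  short : length (candidates m b) ≤ N
  short = ℕ.≤-trans (length-candidates m b) sm^b≤N

  ∣T∣≤b : ∣ T ∣ ≤ b
  ∣T∣≤b = ℕ.m+n≤o⇒m≤o ∣ T ∣ (ℕ.≤-reflexive (All.head (subst (All (WithinBudget b)) eq (candidates-budget m b))))

  best : IsBest As b (proj₁ chosen)
  best = chooseAll-best As b T ∣T∣≤b

  fast : N * w ⊢⟨ finish , o ∷ nil ∷ nil ∷ nil ∷ nil ∷ nil ∷ encodeCandidates As (candidates m b) ∷ ρ ⟩⇓[ 140 ]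
    (encodeSubset (proj₁ chosen) ∷ nil ∷ nil ∷ nil ∷ nil ∷ unary (proj₂ chosen) ∷ nil ∷ ρ)
  fast rewrite eq = relax (set ▸ set ▸
    chooseAllCmd-run As T 0 ((r , T) ∷ cs) n≤w (subst (λ cs → length cs ≤ N) eq short))

length<size : ∀ ts → length ts < size (encodeList ts)
length<size []       = s≤s z≤n
length<size (t ∷ ts) = s≤s (ℕ.≤-trans (length<size ts) (ℕ.m≤n+m _ (size t)))

-- Without any set, the encoding would bear no trace of `n`; one row already has `n` entries.
n≤size : ∀ I .{{_ : NonZero (m I)}} → n I ≤ size (encode I)
n≤size I@record { sets = A ∷ As } = begin
  n I                       ≡⟨ length-bits A ⟨
  length (bits A)           ≤⟨ ℕ.<⇒≤ (length<size (bits A)) ⟩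
  size (encodeSubset A)     ≤⟨ ℕ.m≤m+n _ (size rest) ⟩
  size (encodeSubset A) + size rest ≤⟨ ℕ.n≤1+n _ ⟩
  size (cons (encodeSubset A) rest) ≤⟨ ℕ.m≤n+m _ (suc (size k)) ⟩
  size (encode I)           ∎
  where
  open ℕ.≤-Reasoning
  k rest : Tree
  k    = encodeℕᵇ (fromℕ (K I))
  rest = encodeList (List.map encodeSubset (Vec.toList As))

m<size : ∀ I → m I < size (encode I)
m<size I = begin-strict
  m I               ≡⟨ trans (List.length-map encodeSubset (Vec.toList (sets I))) (Vec.length-toList (sets I)) ⟨
  length rows       <⟨ length<size rows ⟩
  size (encodeList rows) ≤⟨ ℕ.m≤n+m _ (suc (size (encodeℕᵇ (fromℕ (K I))))) ⟩
  size (encode I)   ∎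
  where
  open ℕ.≤-Reasoning
  rows : List Tree
  rows = List.map encodeSubset (Vec.toList (sets I))

-- 402 is 80 for `prepare`, 180 for `enumerate` and 140 for `finish`, plus 2 for the sequencing
-- between them.
programCost : ℕ → ℕ
programCost K₀ = suc (truncateCost K₀ K₀ + 402)

program-correct : ∀ K₀ I .{{_ : NonZero (m I)}} →
  ∃[ T ] (program K₀ on encode I ⇒ encodeSubset T
            within (programCost K₀ * size (encode I) ^ (2 + K₀) + programCost K₀))
       × ∃[ b ] IsBudget (K I) K₀ b × IsBest (sets I) b T
program-correct K₀ I = go
  (truncate-run {s} (K I) K₀ K₀ {encodeList (List.map encodeSubset (Vec.toList (sets I)))}
    {Vec.replicate 8 nil} {nil} (ℕ.≤-<-connex K₀ (K I)) ℕ.≤-refl)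
  where
  s P W : ℕ
  s = size (encode I)
  P = s ^ K₀
  -- One factor `s` for the sets, `P` for the candidates in each round, and `s` for the elements of
  -- a union.
  W = s * (P * s)

  instance
    P≢0 : NonZero P
    P≢0 = ℕ.m^n≢0 s K₀
    Ps≢0 : NonZero (P * s)
    Ps≢0 = ℕ.m*n≢0 P s
    W≢0 : NonZero W
    W≢0 = ℕ.m*n≢0 s (P * s)

  s≤W : s ≤ W
  s≤W = ℕ.m≤m*n s (P * s)

  n≤s : n I ≤ s
  n≤s = n≤size I

  m≤s : m I ≤ s
  m≤s = ℕ.<⇒≤ (m<size I)

  initial : Store 10
  initial = encode I ∷ Vec.replicate 9 nil

  Result : Set
  Result = ∃[ T ] (program K₀ on encode I ⇒ encodeSubset T within (programCost K₀ * s ^ (2 + K₀) + programCost K₀))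
         × ∃[ b ] IsBudget (K I) K₀ b × IsBest (sets I) b T

  withinTime : ∀ {T τ} → W ⊢⟨ body K₀ , initial ⟩⇓[ programCost K₀ ] (encodeSubset T ∷ τ) →
    program K₀ on encode I ⇒ encodeSubset T within (programCost K₀ * s ^ (2 + K₀) + programCost K₀)
  withinTime (run {t} r t≤) = t , _ , r , refl , ℕ.≤-trans t≤ (ℕ.≤-trans
    (ℕ.≤-reflexive (cong (λ k → programCost K₀ * (s * k)) (ℕ.*-comm P s))) (ℕ.m≤m+n _ (programCost K₀)))

  go : ∃[ τ ] s ⊢⟨ truncate K₀ K₀ , initial ⟩⇓[ truncateCost K₀ K₀ ] τ
         × ∃[ b ] (IsBudget (K I) K₀ b × τ ≡ encode I ∷ Vec.replicate 8 nil Vec.++ unary b ∷ []) → Result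
  go (_ , truncated , b , budget@(_ , b≤K₀ , _) , refl) =
    let T , d , best , finished = finish-run (sets I) n≤s enough
        whole = reweigh s≤W truncated
              ▸ reweigh s≤W (prepare-run (sets I) n≤s m≤s)
              ▸ enumerate-run (sets I) n≤s enough m≤s
              ▸ reweigh (ℕ.m≤n*m (P * s) s) finished
    in T , withinTime {T} whole , b , budget , best
    where
    enough : suc (m I) ^ b ≤ P
    -- The strictness of `m<size` gives `1 + m ≤ s`, the base of the power.
    enough = ℕ.≤-trans (ℕ.^-monoˡ-≤ b (m<size I)) (ℕ.^-monoʳ-≤ s b≤K₀)

-- The approximation ratio

OPT≤n : ∀ I → OPT I ≤ n I
OPT≤n I = let T , _ , eq = OPT-attained I in subst (_≤ n I) eq (∣p∣≤n (⋃[ T ] sets I))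

best-ratio : ∀ I {K₀ b T} d → IsBudget (K I) K₀ b → IsBest (sets I) b T →
  (∃[ T′ ] ∣ T′ ∣ ≤ K₀ × d * n I ≤ suc d * coverage I T′) →
  d * OPT I ≤ suc d * coverage I T
best-ratio I {T = T} d (_ , _ , inj₁ refl) (_ , T-best) _ =
  let T′ , feasible , eq = OPT-attained I in
  ℕ.*-mono-≤ (ℕ.n≤1+n d) (subst (_≤ coverage I T) eq (T-best T′ feasible))
best-ratio I d (_ , _ , inj₂ refl) (_ , T-best) (T′ , ∣T′∣≤K₀ , h) =
  ℕ.≤-trans (ℕ.*-monoʳ-≤ d (OPT≤n I)) (ℕ.≤-trans h (ℕ.*-monoʳ-≤ (suc d) (T-best T′ ∣T′∣≤K₀)))

mainTheorem9 : ∀ (α : ℝ) → 0ᴿ <ᴿ α → α ≤ᴿ 1ᴿ → HasPTAS (IsαMaxCover α)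
mainTheorem9 α 0<α _ β _ β<1 with ·≤-fromℕ β β<1 | ≤-fraction α 0<α
... | d , ratio≥β | a , frequency≥α = program K₀ , programCost K₀ , 2 + K₀ , correct
  where
  K₀ : ℕ
  -- `suc a` in place of `a` is nonzero by form, as the cancellation in `few-sets-suffice` requires;
  -- the density bound is weakened to `1/(2 + a)` accordingly.
  K₀ = suc a * d

  K₀-sets : ∀ I → IsαMaxCover α I → ∃[ T ] ∣ T ∣ ≤ K₀ × d * n I ≤ suc d * coverage I T
  K₀-sets I@record { m = suc _ } (m≢0 , p , p≤deg , α≤p/m) = few-sets-suffice (sets I) (suc a) d p≤deg
    (ℕ.≤-trans (frequency≥α p (m I) {{m≢0}} α≤p/m) (ℕ.*-monoˡ-≤ p (ℕ.n≤1+n (suc a))))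

  correct : ∀ I → IsαMaxCover α I →
    ∃[ T ] (program K₀ on encode I ⇒ encodeSubset T
              within (programCost K₀ * size (encode I) ^ (2 + K₀) + programCost K₀))
         × Feasible I T × β · OPT I ≤ᴿ fromℕᴿ (coverage I T)
  correct I isα@(m≢0 , _) =
    let T , computed , b , budget@(b≤K , _) , best@(∣T∣≤b , _) = program-correct K₀ I {{m≢0}} in
    T , computed , ℕ.≤-trans ∣T∣≤b b≤K
      , ratio≥β (OPT I) (coverage I T) (best-ratio I {T = T} d budget best (K₀-sets I isα))
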